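{- Up to equivalence, there are exactly $7$ weighing matrices of order $12$ and weight $8$.
   Context: A weighing matrix of order $n$ and weight $k$ is an $n\times n$ matrix $W$ with entries in $\{1,-1,0\}$ such that $WW^T=kI_n$. Two weighing matrices $W_1,W_2$ of order $n$ are equivalent if $W_1=PW_2Q$ for some $n\times n$ monomial matrices $P,Q$ with nonzero entries in $\{1,-1\}$. -}

module Defs where

open import Data.Nat using (ℕ; zero; suc)
open import Data.Fin using (Fin; zero; suc)
open import Data.Integer using (ℤ; 0ℤ; 1ℤ; -1ℤ; _+_; _*_)
open import Data.Product using (Σ; ∃; ∃-syntax; _×_; _,_)
open import Data.Sum using (_⊎_)
open import Relation.Binary.PropositionalEquality using (_≡_; _≢_)
open import Relation.Nullary using (yes; no)

Matrix : ℕ → Set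
Matrix n = Fin n → Fin n → ℤ

sumFin : ∀ {n} → (Fin n → ℤ) → ℤ
sumFin {zero}  f = 0ℤ
sumFin {suc n} f = f zero + sumFin (λ k → f (suc k))

_⊗_ : ∀ {n} → Matrix n → Matrix n → Matrix n
(A ⊗ B) i j = sumFin (λ k → A i k * B k j)

_ᵀ : ∀ {n} → Matrix n → Matrix n
(A ᵀ) i j = A j i

scalarId : ∀ {n} → ℤ → Matrix n
scalarId {n} k i j with i Data.Fin.≟ j
... | yes _ = k
... | no  _ = 0ℤ

_≋_ : ∀ {n} → Matrix n → Matrix n → Set
A ≋ B = ∀ i j → A i j ≡ B i j

Ternary : ℤ → Set
Ternary x = (x ≡ 1ℤ) ⊎ (x ≡ -1ℤ) ⊎ (x ≡ 0ℤ)

Sign : ℤ → Set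
Sign x = (x ≡ 1ℤ) ⊎ (x ≡ -1ℤ)

IsWeighing : (n : ℕ) → ℕ → Matrix n → Set
IsWeighing n k W = (∀ i j → Ternary (W i j)) × ((W ⊗ (W ᵀ)) ≋ scalarId (Data.Integer.+ k))

IsSignedMonomial : (n : ℕ) → Matrix n → Set
IsSignedMonomial n M =
  (∀ i j → M i j ≢ 0ℤ → Sign (M i j)) ×
  (∀ i → ∃[ j ] (M i j ≢ 0ℤ × (∀ j′ → M i j′ ≢ 0ℤ → j′ ≡ j))) ×
  (∀ j → ∃[ i ] (M i j ≢ 0ℤ × (∀ i′ → M i′ j ≢ 0ℤ → i′ ≡ i)))

Equivalent : (n : ℕ) → Matrix n → Matrix n → Set
Equivalent n W₁ W₂ =
  ∃[ P ] ∃[ Q ] (IsSignedMonomial n P × IsSignedMonomial n Q × (W₁ ≋ ((P ⊗ W₂) ⊗ Q)))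

{-# OPTIONS --safe #-}
module Submission where

-- A configuration (a set of mutually orthogonal ternary rows, up to signed permutations) is settled if
-- every weighing matrix containing it is equivalent to one of the seven representatives. All columns of
-- a weighing matrix have weight 8 too, so a matrix containing a configuration with fewer than 8 nonzero
-- (or 4 zero) entries in column j contains a further row that is nonzero (or zero) there. A configuration
-- is therefore settled once each of its extensions by such a row contains a settled configuration. A
-- certificate lists 125 configurations in an order in which every extension contains an earlier one,
-- starting from the representatives and ending with the empty configuration. The representatives are
-- told apart by the invariant Σ_abc |Σ_j W_aj² W_bj W_cj|.

open import Algebra.Bundles using (CommutativeMonoid)
import Algebra.Properties.CommutativeMonoid.Sum as Sum
import Algebra.Properties.Semiring.Sum as SemiringSum
open import Defs
open import Data.Bool using (Bool; true; false; if_then_else_; _∧_; T)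
open import Data.Bool.Properties using (T-∧; T-≡)
open import Data.Fin using (Fin; zero; suc)
import Data.Fin as Fin
import Data.Fin.Properties as Fin
open import Data.Fin.Permutation using (Permutation′; permutation; transpose; _⟨$⟩ʳ_)
open import Data.Integer using (ℤ; +_; -[1+_]; 0ℤ; 1ℤ; -1ℤ; ∣_∣)
import Data.Integer as ℤ
import Data.Integer.Properties as ℤ
open import Data.Integer.Tactic.RingSolver using (solve-∀)
open import Data.List using (List; []; _∷_; _++_)
import Data.List as List
open import Data.List.Membership.Propositional using (_∈_)
open import Data.List.Membership.Propositional.Properties using (∈-++⁺ˡ; ∈-++⁺ʳ; ∈-map⁺; ∈-filter⁺)
open import Data.List.Relation.Unary.All using ([]; _∷_)
import Data.List.Relation.Unary.All as ListAll
import Data.List.Relation.Unary.All.Properties as ListAll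
open import Data.List.Relation.Unary.Any using (here; there)
open import Data.Maybe using (Maybe; just; nothing)
import Data.Maybe as Maybe
open import Data.Nat using (ℕ; zero; suc; _+_; _*_; _≤_; _<_; _≤ᵇ_; _<ᵇ_; _∸_; z≤n; s≤s)
open import Data.Nat.DivMod using (_/_; _%_; _mod_)
open import Data.Nat.Induction using (<-wellFounded)
import Data.Nat.Properties as ℕ
open import Data.Sign using () renaming (Sign to Signum; + to plus; - to minus; _*_ to _⋆_)
open import Data.Product using (Σ; ∃; ∃₂; ∃-syntax; _×_; _,_; proj₁; proj₂)
open import Data.Sum using (inj₁; inj₂)
open import Data.Unit using (⊤; tt)
open import Data.Vec using (Vec; []; _∷_; lookup; tabulate; replicate)
import Data.Vec as Vec
open import Data.Vec.Properties using (≡-dec; lookup-map; lookup-replicate; lookup∘tabulate)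
open import Data.Vec.Relation.Unary.All using (All; []; _∷_)
import Data.Vec.Relation.Unary.All as All
import Data.Vec.Relation.Unary.All.Properties as All
open import Function using (_∘_; id; Equivalence; Injection)
open import Function.Definitions using (Injective; StrictlySurjective)
open import Function.Properties.Inverse using (↔⇒↣)
open import Induction.WellFounded using (Acc; acc)
open import Relation.Binary.Definitions using (DecidableEquality)
open import Relation.Binary.PropositionalEquality
open import Relation.Nullary using (¬_; Dec; yes; no; does; contradiction; _×-dec_; _→-dec_; ¬?)
open import Relation.Nullary.Decidable using (⌊_⌋; toWitness; dec-true)
open import Relation.Unary using (Pred; Decidable)

open SemiringSum ℤ.+-*-semiring using () renaming
  (sum to ∑; sum-cong-≗ to ∑-cong; ∑-comm to ∑-swap; ∑-distrib-+ to ∑-+; *-distribˡ-sum to *-∑; *-distribʳ-sum to ∑-*; sum-permute to ∑-permute)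
open Sum ℕ.+-0-commutativeMonoid using () renaming
  (sum to ∑ℕ; sum-cong-≗ to ∑ℕ-cong; ∑-comm to ∑ℕ-swap; ∑-distrib-+ to ∑ℕ-+; sum-permute to ∑ℕ-permute)

-- Isomorphism testing is the expensive part of such a classification, so the checker does none: the
-- certificate gives every embedding as an explicit pair of signed maps, which is only compared
-- entry by entry. The one search left is the enumeration of candidate rows, and it is kept small in
-- two ways: the further row is required to exist in a single column only, chosen by the
-- certificate, and it may be brought to a normal form by those signed permutations of columns that
-- leave the given rows alone. "Contains" is weaker than "equals": a reference may discard rows. A
-- small configuration that admits no further row at all is settled vacuously and can then eliminate
-- many larger ones. The invariant needs three rows. Plain inner products of two rows are fixed by
-- orthogonality and distinguish nothing; restricted to the support of a third row (the factor
-- `W_aj²`) they vary from one matrix to another, and the absolute value makes them independent of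
-- signs.

module _ {c ℓ} (M : CommutativeMonoid c ℓ) where
  open CommutativeMonoid M using (Carrier; _≈_; ε; _∙_; identityˡ; identityʳ; ∙-congˡ)
  private module M = CommutativeMonoid M
  open Sum M

  sum-select : ∀ {n} (f : Fin n → Carrier) i →
               sum (λ k → if does (i Fin.≟ k) then f k else ε) ≈ f i
  sum-select {suc n} f zero    = M.trans (∙-congˡ (sum-replicate-zero n)) (identityʳ _)
  sum-select         f (suc i) = M.trans (identityˡ _) (sum-select (f ∘ suc) i)

-- Finite sums and injective self-maps of finite sets.

∑ℕ-mono : ∀ {n} {f g : Fin n → ℕ} → (∀ i → f i ≤ g i) → ∑ℕ f ≤ ∑ℕ g
∑ℕ-mono {zero}  f≤g = z≤n
∑ℕ-mono {suc n} f≤g = ℕ.+-mono-≤ (f≤g zero) (∑ℕ-mono (f≤g ∘ suc))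

term≤∑ℕ : ∀ {n} (f : Fin n → ℕ) i → f i ≤ ∑ℕ f
term≤∑ℕ f zero    = ℕ.m≤m+n _ _
term≤∑ℕ f (suc i) = ℕ.≤-trans (term≤∑ℕ (f ∘ suc) i) (ℕ.m≤n+m _ _)

∑ℕ-const : ∀ n q → ∑ℕ {n} (λ _ → q) ≡ n * q
∑ℕ-const zero    q = refl
∑ℕ-const (suc n) q = cong (_+_ q) (∑ℕ-const n q)

∑-pos : ∀ {n} (f : Fin n → ℕ) → + ∑ℕ f ≡ ∑ (λ i → + f i)
∑-pos {zero}  f = refl
∑-pos {suc n} f = cong (ℤ._+_ (+ f zero)) (∑-pos (f ∘ suc))

-- The last `n` terms contribute at most `n * q`, so the first must contribute `q` to reach the
-- total; cancelling it leaves the same claim for the tail.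
saturated : ∀ {n q} (f : Fin n → ℕ) → (∀ i → f i ≤ q) → ∑ℕ f ≡ n * q → ∀ i → f i ≡ q
saturated {suc n} {q} f f≤q eq = λ where
    zero    → head
    (suc i) → saturated (f ∘ suc) (f≤q ∘ suc) (ℕ.+-cancelˡ-≡ q _ _ (trans (cong (_+ ∑ℕ (f ∘ suc)) (sym head)) eq)) i
  where
  rest : ∑ℕ (f ∘ suc) ≤ n * q
  rest = subst (∑ℕ (f ∘ suc) ≤_) (∑ℕ-const n q) (∑ℕ-mono (f≤q ∘ suc))
  head : f zero ≡ q
  head = ℕ.≤-antisym (f≤q zero)
    (ℕ.+-cancelʳ-≤ (n * q) q (f zero) (subst (_≤ f zero + n * q) eq (ℕ.+-monoʳ-≤ (f zero) rest)))

abstract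
  -- If `y` is missed, `punchOut` at `y` turns `f` into an injection of `Fin (suc n)` into `Fin n`.
  injective⇒surjective : ∀ {n} {f : Fin n → Fin n} → Injective _≡_ _≡_ f → StrictlySurjective _≡_ f
  injective⇒surjective {suc n} {f} inj y with Fin.any? (λ x → f x Fin.≟ y)
  ... | yes hit = hit
  ... | no miss = contradiction
    (Fin.injective⇒≤ (λ {x} {x′} eq → inj (Fin.punchOut-injective (avoids x) (avoids x′) eq)))
    ℕ.1+n≰n
    where
    avoids : ∀ x → y ≢ f x
    avoids x y≡fx = miss (x , sym y≡fx)

injective⇒permutation : ∀ {n} {f : Fin n → Fin n} → Injective _≡_ _≡_ f →
                        ∃ λ (π : Permutation′ n) → ∀ i → π ⟨$⟩ʳ i ≡ f i
injective⇒permutation {f = f} inj =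
  permutation f (proj₁ ∘ surj) (proj₂ ∘ surj) (λ i → inj (proj₂ (surj (f i)))) , λ _ → refl
  where surj = injective⇒surjective inj

∑-reindex : ∀ {n} (f : Fin n → ℤ) {τ : Fin n → Fin n} → Injective _≡_ _≡_ τ → ∑ (f ∘ τ) ≡ ∑ f
∑-reindex f inj = sym (∑-permute f (proj₁ (injective⇒permutation inj)))

∑ℕ-reindex : ∀ {n} (f : Fin n → ℕ) {τ : Fin n → Fin n} → Injective _≡_ _≡_ τ → ∑ℕ (f ∘ τ) ≡ ∑ℕ f
∑ℕ-reindex f inj = sym (∑ℕ-permute f (proj₁ (injective⇒permutation inj)))

abstract
  -- This produces the further row of a weighing matrix: `f` will be the tally of one column and `ρ`
  -- the rows in use. If every index with `f i ≢ 0` were some `ρ a`, counting the pairs with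
  -- `ρ a ≡ i` in both orders would bound the whole sum by the sum over `ρ`.
  fresh : ∀ {k l} (f : Fin l → ℕ) (ρ : Fin k → Fin l) → ∑ℕ (f ∘ ρ) < ∑ℕ f →
          ∃ λ i → (∀ a → ρ a ≢ i) × f i ≢ 0
  fresh {k} {l} f ρ lt with Fin.any? (λ i → Fin.all? (λ a → ¬? (ρ a Fin.≟ i)) ×-dec ¬? (f i ℕ.≟ 0))
  ... | yes found = found
  ... | no none = contradiction bound (ℕ.<⇒≱ lt)
    where
    hit : Fin l → Fin k → ℕ
    hit i a = if does (ρ a Fin.≟ i) then f i else 0

    covered : ∀ i → f i ≤ ∑ℕ (hit i)
    covered i with f i ℕ.≟ 0 | Fin.any? (λ a → ρ a Fin.≟ i)
    ... | yes f≡0 | _ = subst (_≤ ∑ℕ (hit i)) (sym f≡0) z≤n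
    ... | no f≢0 | no miss = contradiction (i , (λ a eq → miss (a , eq)) , f≢0) none
    ... | no _ | yes (a , eq) = subst (_≤ ∑ℕ (hit i)) (cong (if_then f i else 0) (dec-true (ρ a Fin.≟ i) eq)) (term≤∑ℕ (hit i) a)

    bound : ∑ℕ f ≤ ∑ℕ (f ∘ ρ)
    bound = begin
      ∑ℕ f                          ≤⟨ ∑ℕ-mono covered ⟩
      ∑ℕ (λ i → ∑ℕ (hit i))         ≡⟨ ∑ℕ-swap hit ⟩
      ∑ℕ (λ a → ∑ℕ (λ i → hit i a)) ≡⟨ ∑ℕ-cong (λ a → sum-select ℕ.+-0-commutativeMonoid f (ρ a)) ⟩
      ∑ℕ (f ∘ ρ)                    ∎
      where open ℕ.≤-Reasoning


-- Ternary entries, signs and tallies.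

data Trit : Set where
  ⊕ ⊖ ⊙ : Trit

val : Trit → ℤ
val ⊕ = 1ℤ
val ⊖ = -1ℤ
val ⊙ = 0ℤ

signum : Signum → ℤ
signum plus  = 1ℤ
signum minus = -1ℤ

infixr 7 _▹_
_▹_ : Signum → Trit → Trit
plus  ▹ x = x
minus ▹ ⊕ = ⊖
minus ▹ ⊖ = ⊕
minus ▹ ⊙ = ⊙

val-▹ : ∀ s x → val (s ▹ x) ≡ signum s ℤ.* val x
val-▹ plus  x = sym (ℤ.*-identityˡ (val x))
val-▹ minus ⊕ = refl
val-▹ minus ⊖ = refl
val-▹ minus ⊙ = refl

▹-⋆ : ∀ s t x → (s ⋆ t) ▹ x ≡ s ▹ t ▹ x
▹-⋆ plus  t     x = refl
▹-⋆ minus plus  x = refl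
▹-⋆ minus minus ⊕ = refl
▹-⋆ minus minus ⊖ = refl
▹-⋆ minus minus ⊙ = refl

▹-comm : ∀ s t x → s ▹ t ▹ x ≡ t ▹ s ▹ x
▹-comm plus  t     x = refl
▹-comm minus plus  x = refl
▹-comm minus minus x = refl

▹-involutive : ∀ s x → s ▹ s ▹ x ≡ x
▹-involutive plus  x = refl
▹-involutive minus x = sym (▹-⋆ minus minus x)

signum² : ∀ s → signum s ℤ.* signum s ≡ 1ℤ
signum² plus  = refl
signum² minus = refl

-- The flag stands for the two kinds of branching, on a row that is zero (`true`) or nonzero
-- (`false`) in a column. Treating both at once, it recurs in `quota`, `goal` and the certificate.
tally : Bool → Trit → ℕ
tally true  ⊙ = 1
tally true  _ = 0
tally false ⊙ = 0
tally false _ = 1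

tally-false : ∀ x → + tally false x ≡ val x ℤ.* val x
tally-false ⊕ = refl
tally-false ⊖ = refl
tally-false ⊙ = refl

tally-total : ∀ x → tally true x + tally false x ≡ 1
tally-total ⊕ = refl
tally-total ⊖ = refl
tally-total ⊙ = refl

quota : ℕ → ℕ → Bool → ℕ
quota n q true  = n ∸ q
quota n q false = q

tally-quota : ∀ {n q} (f : Fin n → Trit) → ∑ℕ (tally false ∘ f) ≡ q → ∀ b → ∑ℕ (tally b ∘ f) ≡ quota n q b
tally-quota f w false = w
tally-quota {n} {q} f w true = begin
  ∑ℕ (tally true ∘ f)                                   ≡⟨ ℕ.m+n∸n≡m _ q ⟨
  ∑ℕ (tally true ∘ f) + q ∸ q                           ≡⟨ cong (λ m → ∑ℕ (tally true ∘ f) + m ∸ q) w ⟨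
  ∑ℕ (tally true ∘ f) + ∑ℕ (tally false ∘ f) ∸ q        ≡⟨ cong (_∸ q) (∑ℕ-+ (tally true ∘ f) (tally false ∘ f)) ⟨
  ∑ℕ (λ j → tally true (f j) + tally false (f j)) ∸ q   ≡⟨ cong (_∸ q) (trans (∑ℕ-cong (tally-total ∘ f)) (trans (∑ℕ-const n 1) (ℕ.*-identityʳ n))) ⟩
  n ∸ q                                                 ∎
  where open ≡-Reasoning

-- Orthogonal patterns and their column weights.

Pattern : ℕ → ℕ → Set
Pattern k n = Fin k → Fin n → Trit

dot : ∀ {n} → (Fin n → Trit) → (Fin n → Trit) → ℤ
dot u v = ∑ (λ j → val (u j) ℤ.* val (v j))

-- The number of rows is independent of their length, so that this covers weighing matrices and also
-- the configurations inside them.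
record Orthogonal {k n} (q : ℕ) (W : Pattern k n) : Set where
  field
    norm : ∀ i → dot (W i) (W i) ≡ + q
    orth : ∀ {i i′} → i ≢ i′ → dot (W i) (W i′) ≡ 0ℤ

open Orthogonal

weight : ∀ {n} (u : Fin n → Trit) → + ∑ℕ (tally false ∘ u) ≡ dot u u
weight u = trans (∑-pos (tally false ∘ u)) (∑-cong (tally-false ∘ u))

-- Both sides are the bilinear form of the matrix `y` at the vectors `f` and `x`, summed in the two
-- possible orders. Both Gram computations below are instances.
∑-exchange : ∀ {m n} (f : Fin m → ℤ) (x : Fin n → ℤ) (y : Fin m → Fin n → ℤ) →
             ∑ (λ l → x l ℤ.* ∑ (λ i → f i ℤ.* y i l)) ≡ ∑ (λ i → f i ℤ.* ∑ (λ l → x l ℤ.* y i l))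
∑-exchange f x y = begin
  ∑ (λ l → x l ℤ.* ∑ (λ i → f i ℤ.* y i l))    ≡⟨ ∑-cong (λ l → *-∑ (x l) (λ i → f i ℤ.* y i l)) ⟩
  ∑ (λ l → ∑ (λ i → x l ℤ.* (f i ℤ.* y i l)))  ≡⟨ ∑-swap (λ l i → x l ℤ.* (f i ℤ.* y i l)) ⟩
  ∑ (λ i → ∑ (λ l → x l ℤ.* (f i ℤ.* y i l)))  ≡⟨ ∑-cong (λ i → ∑-cong (λ l → rearrange (x l) (f i) (y i l))) ⟩
  ∑ (λ i → ∑ (λ l → f i ℤ.* (x l ℤ.* y i l)))  ≡⟨ ∑-cong (λ i → *-∑ (f i) (λ l → x l ℤ.* y i l)) ⟨
  ∑ (λ i → f i ℤ.* ∑ (λ l → x l ℤ.* y i l))    ∎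
  where
  open ≡-Reasoning
  rearrange : ∀ a b c → a ℤ.* (b ℤ.* c) ≡ b ℤ.* (a ℤ.* c)
  rearrange = solve-∀

-- With g_jl = Σ_i W_ij W_il, orthogonality of the rows gives Σ_l g_jl² = q g_jj, so g_jj² ≤ q g_jj
-- bounds every column weight g_jj by q; the weights add up to n q, so all are equal to q.
module ColumnWeight {n q} {W : Pattern n n} (W-orth : Orthogonal q W) where
  private
    w : Fin n → Fin n → ℤ
    w i j = val (W i j)

    g : Fin n → Fin n → ℤ
    g j l = ∑ (λ i → w i j ℤ.* w i l)

    c : Fin n → ℕ
    c j = ∑ℕ (λ i → tally false (W i j))

    c-g : ∀ j → + c j ≡ g j j
    c-g j = weight (λ i → W i j)

    gram : ∀ i i′ → dot (W i) (W i′) ≡ (if does (i Fin.≟ i′) then + q else 0ℤ)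
    gram i i′ with i Fin.≟ i′
    ... | yes refl = norm W-orth i
    ... | no i≢i′  = orth W-orth i≢i′

    -- Entry `(i, j)` of `W (WᵀW) = (W Wᵀ) W = q W`. Multiplying once more by `Wᵀ` from the left
    -- gives `g∙g` on the diagonal.
    w∙g : ∀ j i → ∑ (λ l → w i l ℤ.* g j l) ≡ w i j ℤ.* + q
    w∙g j i = begin
      ∑ (λ l → w i l ℤ.* g j l)                           ≡⟨ ∑-exchange (λ i′ → w i′ j) (w i) w ⟩
      ∑ (λ i′ → w i′ j ℤ.* dot (W i) (W i′))              ≡⟨ ∑-cong (λ i′ → trans (cong (w i′ j ℤ.*_) (gram i i′)) (push i′)) ⟩
      ∑ (λ i′ → if does (i Fin.≟ i′) then w i′ j ℤ.* + q else 0ℤ) ≡⟨ sum-select ℤ.+-0-commutativeMonoid (λ i′ → w i′ j ℤ.* + q) i ⟩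
      w i j ℤ.* + q                                       ∎
      where
      open ≡-Reasoning
      push : ∀ i′ → w i′ j ℤ.* (if does (i Fin.≟ i′) then + q else 0ℤ) ≡ (if does (i Fin.≟ i′) then w i′ j ℤ.* + q else 0ℤ)
      push i′ with does (i Fin.≟ i′)
      ... | true  = refl
      ... | false = ℤ.*-zeroʳ (w i′ j)

    g∙g : ∀ j → ∑ (λ l → g j l ℤ.* g j l) ≡ + c j ℤ.* + q
    g∙g j = begin
      ∑ (λ l → g j l ℤ.* g j l)                         ≡⟨ ∑-exchange (λ i → w i j) (g j) w ⟩
      ∑ (λ i → w i j ℤ.* ∑ (λ l → g j l ℤ.* w i l))     ≡⟨ ∑-cong (λ i → cong (w i j ℤ.*_) (trans (∑-cong (λ l → ℤ.*-comm (g j l) (w i l))) (w∙g j i))) ⟩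
      ∑ (λ i → w i j ℤ.* (w i j ℤ.* + q))               ≡⟨ ∑-cong (λ i → sym (ℤ.*-assoc (w i j) (w i j) (+ q))) ⟩
      ∑ (λ i → w i j ℤ.* w i j ℤ.* + q)                 ≡⟨ ∑-* (+ q) (λ i → w i j ℤ.* w i j) ⟨
      g j j ℤ.* + q                                     ≡⟨ cong (ℤ._* + q) (c-g j) ⟨
      + c j ℤ.* + q                                     ∎
      where open ≡-Reasoning

    square : ℤ → ℕ
    square i = ∣ i ∣ * ∣ i ∣

    +square : ∀ i → + square i ≡ i ℤ.* i
    +square (+ n)    = ℤ.pos-* n n
    +square -[1+ n ] = refl

    c² : ∀ j → c j * c j ≤ q * c j
    c² j = begin
      c j * c j                   ≡⟨ cong square (c-g j) ⟩
      square (g j j)              ≤⟨ term≤∑ℕ (λ l → square (g j l)) j ⟩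
      ∑ℕ (λ l → square (g j l))   ≡⟨ ℤ.+-injective (trans (∑-pos (λ l → square (g j l))) (trans (∑-cong (λ l → +square (g j l))) (trans (g∙g j) (sym (ℤ.pos-* (c j) q))))) ⟩
      c j * q                     ≡⟨ ℕ.*-comm (c j) q ⟩
      q * c j                     ∎
      where open ℕ.≤-Reasoning

    cancel : ∀ m → m * m ≤ q * m → m ≤ q
    cancel zero    _ = z≤n
    cancel (suc m)   = ℕ.*-cancelʳ-≤ (suc m) q (suc m)

    c≤q : ∀ j → c j ≤ q
    c≤q j = cancel (c j) (c² j)

    total : ∑ℕ c ≡ n * q
    total = begin
      ∑ℕ c                                        ≡⟨ ∑ℕ-swap (λ j i → tally false (W i j)) ⟩
      ∑ℕ (λ i → ∑ℕ (λ j → tally false (W i j)))   ≡⟨ ∑ℕ-cong (λ i → ℤ.+-injective (trans (weight (W i)) (norm W-orth i))) ⟩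
      ∑ℕ {n} (λ _ → q)                            ≡⟨ ∑ℕ-const n q ⟩
      n * q                                       ∎
      where open ≡-Reasoning

  column-weight : ∀ j → ∑ℕ (λ i → tally false (W i j)) ≡ q
  column-weight = saturated c c≤q total

open ColumnWeight using (column-weight)

row-weight : ∀ {k n q} {W : Pattern k n} → Orthogonal q W → ∀ i → ∑ℕ (tally false ∘ W i) ≡ q
row-weight {W = W} W-orth i = ℤ.+-injective (trans (weight (W i)) (norm W-orth i))

-- Containment of patterns up to signed permutations.

infix 4 _⊑_
-- Only rows can be left out: `τ`, an injective self-map of `Fin n`, is a permutation. All maps and
-- signs are indexed by `A`, whose entries are read off from `B`, so that composition needs no
-- inverses.
record _⊑_ {k l n} (A : Pattern k n) (B : Pattern l n) : Set where
  constructor embedding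
  field
    ρ      : Fin k → Fin l
    ρ-inj  : Injective _≡_ _≡_ ρ
    s      : Fin k → Signum
    τ      : Fin n → Fin n
    τ-inj  : Injective _≡_ _≡_ τ
    t      : Fin n → Signum
    agrees : ∀ a j → A a j ≡ s a ▹ t j ▹ B (ρ a) (τ j)

⊑-trans : ∀ {k l m n} {A : Pattern k n} {B : Pattern l n} {C : Pattern m n} → A ⊑ B → B ⊑ C → A ⊑ C
⊑-trans {A = A} {B} {C} (embedding ρ ρ-inj s τ τ-inj t A≈B) (embedding ρ′ ρ′-inj s′ τ′ τ′-inj t′ B≈C) =
  embedding (ρ′ ∘ ρ) (ρ-inj ∘ ρ′-inj) (λ a → s a ⋆ s′ (ρ a)) (τ′ ∘ τ) (τ-inj ∘ τ′-inj) (λ j → t j ⋆ t′ (τ j)) λ a j → begin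
    A a j                                                   ≡⟨ A≈B a j ⟩
    s a ▹ t j ▹ B (ρ a) (τ j)                               ≡⟨ cong (λ x → s a ▹ t j ▹ x) (B≈C (ρ a) (τ j)) ⟩
    s a ▹ t j ▹ s′ (ρ a) ▹ t′ (τ j) ▹ C (ρ′ (ρ a)) (τ′ (τ j)) ≡⟨ cong (s a ▹_) (▹-comm (t j) (s′ (ρ a)) _) ⟩
    s a ▹ s′ (ρ a) ▹ t j ▹ t′ (τ j) ▹ C (ρ′ (ρ a)) (τ′ (τ j)) ≡⟨ ▹-⋆ (s a) (s′ (ρ a)) _ ⟨
    (s a ⋆ s′ (ρ a)) ▹ t j ▹ t′ (τ j) ▹ C (ρ′ (ρ a)) (τ′ (τ j)) ≡⟨ cong ((s a ⋆ s′ (ρ a)) ▹_) (▹-⋆ (t j) (t′ (τ j)) _) ⟨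
    (s a ⋆ s′ (ρ a)) ▹ (t j ⋆ t′ (τ j)) ▹ C (ρ′ (ρ a)) (τ′ (τ j)) ∎
  where open ≡-Reasoning

-- A column sign occurs twice in each product and squares to 1, and the column map only reorders the
-- sum; the two row signs are all that survives.
⊑-dot : ∀ {k l n} {A : Pattern k n} {B : Pattern l n} (A⊑B : A ⊑ B) → ∀ a b →
        dot (A a) (A b) ≡ (signum (_⊑_.s A⊑B a) ℤ.* signum (_⊑_.s A⊑B b)) ℤ.* dot (B (_⊑_.ρ A⊑B a)) (B (_⊑_.ρ A⊑B b))
⊑-dot {A = A} {B} A⊑B a b = begin
  ∑ (λ j → val (A a j) ℤ.* val (A b j))  ≡⟨ ∑-cong term ⟩
  ∑ (λ j → σ ℤ.* product (τ j))          ≡⟨ *-∑ σ (product ∘ τ) ⟨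
  σ ℤ.* ∑ (product ∘ τ)                  ≡⟨ cong (σ ℤ.*_) (∑-reindex product τ-inj) ⟩
  σ ℤ.* dot (B (ρ a)) (B (ρ b))          ∎
  where
  open ≡-Reasoning
  open _⊑_ A⊑B
  σ = signum (s a) ℤ.* signum (s b)
  product = λ j → val (B (ρ a) j) ℤ.* val (B (ρ b) j)

  entry-val : ∀ a j → val (A a j) ≡ signum (s a) ℤ.* (signum (t j) ℤ.* val (B (ρ a) (τ j)))
  entry-val a j = trans (cong val (agrees a j))
    (trans (val-▹ (s a) _) (cong (signum (s a) ℤ.*_) (val-▹ (t j) _)))

  rearrange : ∀ p q r x y → (p ℤ.* (r ℤ.* x)) ℤ.* (q ℤ.* (r ℤ.* y)) ≡ (r ℤ.* r) ℤ.* ((p ℤ.* q) ℤ.* (x ℤ.* y))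
  rearrange = solve-∀

  term : ∀ j → val (A a j) ℤ.* val (A b j) ≡ σ ℤ.* product (τ j)
  term j = begin
    val (A a j) ℤ.* val (A b j)                               ≡⟨ cong₂ ℤ._*_ (entry-val a j) (entry-val b j) ⟩
    _                                                         ≡⟨ rearrange (signum (s a)) (signum (s b)) (signum (t j)) _ _ ⟩
    signum (t j) ℤ.* signum (t j) ℤ.* (σ ℤ.* product (τ j))   ≡⟨ cong (ℤ._* (σ ℤ.* product (τ j))) (signum² (t j)) ⟩
    1ℤ ℤ.* (σ ℤ.* product (τ j))                              ≡⟨ ℤ.*-identityˡ _ ⟩
    σ ℤ.* product (τ j)                                       ∎

⊑-orthogonal : ∀ {k l n q} {A : Pattern k n} {B : Pattern l n} → A ⊑ B → Orthogonal q B → Orthogonal q A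
⊑-orthogonal {A = A} {B} A⊑B B-orth = record
  { norm = λ a → trans (⊑-dot A⊑B a a)
      (trans (cong (ℤ._* dot (B (ρ a)) (B (ρ a))) (signum² (s a))) (trans (ℤ.*-identityˡ _) (norm B-orth (ρ a))))
  ; orth = λ {a} {b} a≢b → trans (⊑-dot A⊑B a b)
      (trans (cong (signum (s a) ℤ.* signum (s b) ℤ.*_) (orth B-orth (a≢b ∘ ρ-inj))) (ℤ.*-zeroʳ (signum (s a) ℤ.* signum (s b))))
  }
  where open _⊑_ A⊑B

-- Monomial matrices and equivalence.

sumFin≡∑ : ∀ {n} (f : Fin n → ℤ) → sumFin f ≡ ∑ f
sumFin≡∑ {zero}  f = refl
sumFin≡∑ {suc n} f = cong (ℤ._+_ (f zero)) (sumFin≡∑ (f ∘ suc))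

scaledPermutation : ∀ {n} → (Fin n → Fin n) → (Fin n → ℤ) → Matrix n
scaledPermutation σ c i k = if does (σ i Fin.≟ k) then c i else 0ℤ

-- `Q` is described through its transpose because it acts on columns: `τ j` is then the column of
-- `M` from which column `j` of the product comes, without inverting a permutation.
⊗-scaledPermutation : ∀ {n} {P Q : Matrix n} {σ τ c d} → P ≋ scaledPermutation σ c → (Q ᵀ) ≋ scaledPermutation τ d →
                      ∀ M i j → ((P ⊗ M) ⊗ Q) i j ≡ c i ℤ.* M (σ i) (τ j) ℤ.* d j
⊗-scaledPermutation {P = P} {Q} {σ} {τ} {c} {d} P≋ Q≋ M i j = begin
  sumFin (λ l → sumFin (λ k → P i k ℤ.* M k l) ℤ.* Q l j)  ≡⟨ sumFin≡∑ (λ l → sumFin (λ k → P i k ℤ.* M k l) ℤ.* Q l j) ⟩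
  ∑ (λ l → sumFin (λ k → P i k ℤ.* M k l) ℤ.* Q l j)       ≡⟨ ∑-cong (λ l → cong₂ ℤ._*_ (left l) (Q≋ j l)) ⟩
  ∑ (λ l → c i ℤ.* M (σ i) l ℤ.* (if does (τ j Fin.≟ l) then d j else 0ℤ)) ≡⟨ ∑-cong (λ l → *-if (does (τ j Fin.≟ l)) (c i ℤ.* M (σ i) l)) ⟩
  ∑ (λ l → if does (τ j Fin.≟ l) then c i ℤ.* M (σ i) l ℤ.* d j else 0ℤ) ≡⟨ sum-select ℤ.+-0-commutativeMonoid (λ l → c i ℤ.* M (σ i) l ℤ.* d j) (τ j) ⟩
  c i ℤ.* M (σ i) (τ j) ℤ.* d j ∎
  where
  open ≡-Reasoning

  *-if : ∀ b x {y} → x ℤ.* (if b then y else 0ℤ) ≡ (if b then x ℤ.* y else 0ℤ)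
  *-if true  x = refl
  *-if false x = ℤ.*-zeroʳ x

  if-* : ∀ b {x} y → (if b then x else 0ℤ) ℤ.* y ≡ (if b then x ℤ.* y else 0ℤ)
  if-* true  y = refl
  if-* false y = ℤ.*-zeroˡ y

  left : ∀ l → sumFin (λ k → P i k ℤ.* M k l) ≡ c i ℤ.* M (σ i) l
  left l = begin
    sumFin (λ k → P i k ℤ.* M k l)  ≡⟨ sumFin≡∑ (λ k → P i k ℤ.* M k l) ⟩
    ∑ (λ k → P i k ℤ.* M k l)       ≡⟨ ∑-cong (λ k → trans (cong (ℤ._* M k l) (P≋ i k)) (if-* (does (σ i Fin.≟ k)) (M k l))) ⟩
    ∑ (λ k → if does (σ i Fin.≟ k) then c i ℤ.* M k l else 0ℤ) ≡⟨ sum-select ℤ.+-0-commutativeMonoid (λ k → c i ℤ.* M k l) (σ i) ⟩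
    c i ℤ.* M (σ i) l ∎

Sign⇒≢0 : ∀ {x} → Sign x → x ≢ 0ℤ
Sign⇒≢0 (inj₁ refl) ()
Sign⇒≢0 (inj₂ refl) ()

signum-Sign : ∀ s → Sign (signum s)
signum-Sign plus  = inj₁ refl
signum-Sign minus = inj₂ refl

transpose-monomial : ∀ {n} {M : Matrix n} → IsSignedMonomial n M → IsSignedMonomial n (M ᵀ)
transpose-monomial (signs , rows , columns) = (λ i j → signs j i) , columns , rows

scaledPermutation-monomial : ∀ {n} {σ : Fin n → Fin n} {c} → Injective _≡_ _≡_ σ → (∀ i → Sign (c i)) →
                             IsSignedMonomial n (scaledPermutation σ c)
scaledPermutation-monomial {n} {σ} {c} σ-inj c-sign = signs , rows , columns
  where
  P = scaledPermutation σ c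

  support : ∀ i k → P i k ≢ 0ℤ → σ i ≡ k
  support i k ≢0 with σ i Fin.≟ k
  ... | yes eq = eq
  ... | no _   = contradiction refl ≢0

  value : ∀ {i k} → σ i ≡ k → P i k ≡ c i
  value {i} {k} eq = cong (if_then c i else 0ℤ) (dec-true (σ i Fin.≟ k) eq)

  nonzero : ∀ {i k} → σ i ≡ k → P i k ≢ 0ℤ
  nonzero {i} eq P≡0 = Sign⇒≢0 (c-sign i) (trans (sym (value eq)) P≡0)

  signs : ∀ i k → P i k ≢ 0ℤ → Sign (P i k)
  signs i k ≢0 = subst Sign (sym (value (support i k ≢0))) (c-sign i)

  rows : ∀ i → ∃[ k ] (P i k ≢ 0ℤ × (∀ k′ → P i k′ ≢ 0ℤ → k′ ≡ k))
  rows i = σ i , nonzero refl , λ k′ ≢0 → sym (support i k′ ≢0)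

  columns : ∀ k → ∃[ i ] (P i k ≢ 0ℤ × (∀ i′ → P i′ k ≢ 0ℤ → i′ ≡ i))
  columns k with injective⇒surjective σ-inj k
  ... | i , σi≡k = i , nonzero σi≡k , λ i′ ≢0 → σ-inj (trans (support i′ k ≢0) (sym σi≡k))

-- The row condition yields `σ`, the column condition its injectivity.
monomial⇒scaledPermutation : ∀ {n} {P : Matrix n} → IsSignedMonomial n P →
  ∃[ σ ] ∃[ c ] (Injective _≡_ _≡_ σ × (∀ i → Sign (c i)) × P ≋ scaledPermutation σ c)
monomial⇒scaledPermutation {n} {P} (signs , rows , columns) = σ , c , σ-inj , (λ i → signs i (σ i) (nonzero i)) , entries
  where
  σ : Fin n → Fin n
  σ i = proj₁ (rows i)

  c : Fin n → ℤ
  c i = P i (σ i)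

  nonzero : ∀ i → c i ≢ 0ℤ
  nonzero i = proj₁ (proj₂ (rows i))

  σ-inj : Injective _≡_ _≡_ σ
  σ-inj {i} {i′} eq with columns (σ i)
  ... | _ , _ , unique = trans (unique i (nonzero i)) (sym (unique i′ (subst (λ k → P i′ k ≢ 0ℤ) (sym eq) (nonzero i′))))

  entries : P ≋ scaledPermutation σ c
  entries i k with σ i Fin.≟ k
  ... | yes refl = refl
  ... | no σi≢k with P i k ℤ.≟ 0ℤ
  ...   | yes P≡0 = P≡0
  ...   | no P≢0  = contradiction (sym (proj₂ (proj₂ (rows i)) k P≢0)) σi≢k

-- `A ⊑ W` expresses `A` by the entries of `W`, whereas `Equivalent` asks for `M`, the integer form
-- of `W`, as a product around `A`. Hence both maps are inverted, which is possible because the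
-- patterns are square; signs are their own inverses.
⊑⇒Equivalent : ∀ {n} {A W : Pattern n n} {M : Matrix n} → (∀ i j → val (W i j) ≡ M i j) → A ⊑ W →
               Equivalent n M (λ i j → val (A i j))
⊑⇒Equivalent {n} {A} {W} {M} W≈M (embedding ρ ρ-inj s τ τ-inj t agrees) =
  scaledPermutation ρ⁻¹ c , scaledPermutation τ⁻¹ d ᵀ ,
  scaledPermutation-monomial ρ⁻¹-inj (signum-Sign ∘ s ∘ ρ⁻¹) ,
  transpose-monomial {M = scaledPermutation τ⁻¹ d} (scaledPermutation-monomial τ⁻¹-inj (signum-Sign ∘ t ∘ τ⁻¹)) ,
  λ i j → begin
    M i j                                         ≡⟨ W≈M i j ⟨
    val (W i j)                                   ≡⟨ cong val (cong₂ W (ρρ⁻¹ i) (ττ⁻¹ j)) ⟨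
    val (W (ρ (ρ⁻¹ i)) (τ (τ⁻¹ j)))               ≡⟨ cong val (undo (ρ⁻¹ i) (τ⁻¹ j)) ⟨
    val (t (τ⁻¹ j) ▹ s (ρ⁻¹ i) ▹ A (ρ⁻¹ i) (τ⁻¹ j)) ≡⟨ trans (val-▹ (t (τ⁻¹ j)) _) (cong (d j ℤ.*_) (val-▹ (s (ρ⁻¹ i)) _)) ⟩
    d j ℤ.* (c i ℤ.* val (A (ρ⁻¹ i) (τ⁻¹ j)))     ≡⟨ ℤ.*-comm (d j) _ ⟩
    c i ℤ.* val (A (ρ⁻¹ i) (τ⁻¹ j)) ℤ.* d j       ≡⟨ ⊗-scaledPermutation {σ = ρ⁻¹} {τ⁻¹} {c} {d} (λ _ _ → refl) (λ _ _ → refl) (λ i j → val (A i j)) i j ⟨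
    ((scaledPermutation ρ⁻¹ c ⊗ (λ i j → val (A i j))) ⊗ (scaledPermutation τ⁻¹ d ᵀ)) i j ∎
  where
  open ≡-Reasoning
  ρ⁻¹ τ⁻¹ : Fin n → Fin n
  ρ⁻¹ = proj₁ ∘ injective⇒surjective ρ-inj
  τ⁻¹ = proj₁ ∘ injective⇒surjective τ-inj

  ρρ⁻¹ : ∀ i → ρ (ρ⁻¹ i) ≡ i
  ρρ⁻¹ = proj₂ ∘ injective⇒surjective ρ-inj

  ττ⁻¹ : ∀ j → τ (τ⁻¹ j) ≡ j
  ττ⁻¹ = proj₂ ∘ injective⇒surjective τ-inj

  ρ⁻¹-inj : Injective _≡_ _≡_ ρ⁻¹
  ρ⁻¹-inj {i} {i′} eq = trans (sym (ρρ⁻¹ i)) (trans (cong ρ eq) (ρρ⁻¹ i′))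

  τ⁻¹-inj : Injective _≡_ _≡_ τ⁻¹
  τ⁻¹-inj {j} {j′} eq = trans (sym (ττ⁻¹ j)) (trans (cong τ eq) (ττ⁻¹ j′))

  c d : Fin n → ℤ
  c = signum ∘ s ∘ ρ⁻¹
  d = signum ∘ t ∘ τ⁻¹

  undo : ∀ a j → t j ▹ s a ▹ A a j ≡ W (ρ a) (τ j)
  undo a j = trans (cong (λ x → t j ▹ s a ▹ x) (agrees a j))
    (trans (cong (t j ▹_) (▹-involutive (s a) _)) (▹-involutive (t j) _))

-- An invariant of equivalence.

spread : ∀ {n} → Matrix n → ℕ
spread W = ∑ℕ λ a → ∑ℕ λ b → ∑ℕ λ c → ∣ sumFin (λ j → (W a j ℤ.* W a j) ℤ.* (W b j ℤ.* W c j)) ∣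

-- In each summand the sign of row `a` occurs twice and the column sign four times, so they cancel.
-- The signs of rows `b` and `c` do not depend on `j`, leave the inner sum as a factor and vanish
-- under the absolute value. The permutations `σ` and `τ` only reorder the four sums.
spread-invariant : ∀ {n} {W₁ W₂ : Matrix n} → Equivalent n W₁ W₂ → spread W₁ ≡ spread W₂
spread-invariant {n} {W₁} {W₂} (P , Q , P-mono , Q-mono , W₁≋)
  with monomial⇒scaledPermutation P-mono | monomial⇒scaledPermutation {P = Q ᵀ} (transpose-monomial Q-mono)
... | σ , c , σ-inj , c-sign , P≋ | τ , d , τ-inj , d-sign , Q≋ = begin
  spread W₁                                            ≡⟨ ∑ℕ-cong (λ a → ∑ℕ-cong λ b → ∑ℕ-cong (overlaps a b)) ⟩
  (∑ℕ λ a → ∑ℕ λ b → ∑ℕ λ k → common (σ a) (σ b) (σ k)) ≡⟨ ∑ℕ-cong (λ a → ∑ℕ-cong λ b → ∑ℕ-reindex (common (σ a) (σ b)) σ-inj) ⟩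
  (∑ℕ λ a → ∑ℕ λ b → ∑ℕ λ k → common (σ a) (σ b) k)     ≡⟨ ∑ℕ-cong (λ a → ∑ℕ-reindex (λ b → ∑ℕ (common (σ a) b)) σ-inj) ⟩
  (∑ℕ λ a → ∑ℕ λ b → ∑ℕ λ k → common (σ a) b k)         ≡⟨ ∑ℕ-reindex (λ a → ∑ℕ λ b → ∑ℕ (common a b)) σ-inj ⟩
  spread W₂                                            ∎
  where
  open ≡-Reasoning

  product : Fin n → Fin n → Fin n → Fin n → ℤ
  product a b k j = (W₂ a j ℤ.* W₂ a j) ℤ.* (W₂ b j ℤ.* W₂ k j)

  common : Fin n → Fin n → Fin n → ℕ
  common a b k = ∣ sumFin (product a b k) ∣

  square : ∀ {x} → Sign x → x ℤ.* x ≡ 1ℤ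
  square (inj₁ refl) = refl
  square (inj₂ refl) = refl

  ∣Sign∣ : ∀ {x} → Sign x → ∣ x ∣ ≡ 1
  ∣Sign∣ (inj₁ refl) = refl
  ∣Sign∣ (inj₂ refl) = refl

  entry : ∀ i j → W₁ i j ≡ c i ℤ.* W₂ (σ i) (τ j) ℤ.* d j
  entry i j = trans (W₁≋ i j) (⊗-scaledPermutation {P = P} {Q} {σ} {τ} {c} {d} P≋ Q≋ W₂ i j)

  rearrange : ∀ p q r e x y z →
    ((p ℤ.* x ℤ.* e) ℤ.* (p ℤ.* x ℤ.* e)) ℤ.* ((q ℤ.* y ℤ.* e) ℤ.* (r ℤ.* z ℤ.* e))
      ≡ ((p ℤ.* p) ℤ.* (e ℤ.* e) ℤ.* (e ℤ.* e)) ℤ.* ((q ℤ.* r) ℤ.* ((x ℤ.* x) ℤ.* (y ℤ.* z)))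
  rearrange = solve-∀

  term : ∀ a b k j → (W₁ a j ℤ.* W₁ a j) ℤ.* (W₁ b j ℤ.* W₁ k j) ≡ (c b ℤ.* c k) ℤ.* product (σ a) (σ b) (σ k) (τ j)
  term a b k j = begin
    (W₁ a j ℤ.* W₁ a j) ℤ.* (W₁ b j ℤ.* W₁ k j)  ≡⟨ cong₂ ℤ._*_ (cong₂ ℤ._*_ (entry a j) (entry a j)) (cong₂ ℤ._*_ (entry b j) (entry k j)) ⟩
    _  ≡⟨ rearrange (c a) (c b) (c k) (d j) (W₂ (σ a) (τ j)) (W₂ (σ b) (τ j)) (W₂ (σ k) (τ j)) ⟩
    ((c a ℤ.* c a) ℤ.* (d j ℤ.* d j) ℤ.* (d j ℤ.* d j)) ℤ.* right
      ≡⟨ cong (ℤ._* right) (cong₂ ℤ._*_ (cong₂ ℤ._*_ (square (c-sign a)) (square (d-sign j))) (square (d-sign j))) ⟩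
    1ℤ ℤ.* right                                 ≡⟨ ℤ.*-identityˡ right ⟩
    right                                        ∎
    where right = (c b ℤ.* c k) ℤ.* product (σ a) (σ b) (σ k) (τ j)

  overlaps : ∀ a b k → ∣ sumFin (λ j → (W₁ a j ℤ.* W₁ a j) ℤ.* (W₁ b j ℤ.* W₁ k j)) ∣ ≡ common (σ a) (σ b) (σ k)
  overlaps a b k = begin
    ∣ sumFin (λ j → (W₁ a j ℤ.* W₁ a j) ℤ.* (W₁ b j ℤ.* W₁ k j)) ∣ ≡⟨ cong ∣_∣ (sumFin≡∑ (λ j → (W₁ a j ℤ.* W₁ a j) ℤ.* (W₁ b j ℤ.* W₁ k j))) ⟩
    ∣ ∑ (λ j → (W₁ a j ℤ.* W₁ a j) ℤ.* (W₁ b j ℤ.* W₁ k j)) ∣     ≡⟨ cong ∣_∣ (∑-cong (term a b k)) ⟩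
    ∣ ∑ (λ j → (c b ℤ.* c k) ℤ.* product (σ a) (σ b) (σ k) (τ j)) ∣ ≡⟨ cong ∣_∣ (*-∑ (c b ℤ.* c k) (product (σ a) (σ b) (σ k) ∘ τ)) ⟨
    ∣ (c b ℤ.* c k) ℤ.* ∑ (product (σ a) (σ b) (σ k) ∘ τ) ∣         ≡⟨ cong (λ x → ∣ (c b ℤ.* c k) ℤ.* x ∣) (∑-reindex (product (σ a) (σ b) (σ k)) τ-inj) ⟩
    ∣ (c b ℤ.* c k) ℤ.* ∑ (product (σ a) (σ b) (σ k)) ∣             ≡⟨ cong (λ x → ∣ (c b ℤ.* c k) ℤ.* x ∣) (sumFin≡∑ (product (σ a) (σ b) (σ k))) ⟨
    ∣ (c b ℤ.* c k) ℤ.* sumFin (product (σ a) (σ b) (σ k)) ∣        ≡⟨ ℤ.abs-* (c b ℤ.* c k) _ ⟩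
    ∣ c b ℤ.* c k ∣ * common (σ a) (σ b) (σ k)                      ≡⟨ cong (_* common (σ a) (σ b) (σ k)) (trans (ℤ.abs-* (c b) (c k)) (cong₂ _*_ (∣Sign∣ (c-sign b)) (∣Sign∣ (c-sign k)))) ⟩
    1 * common (σ a) (σ b) (σ k)                                    ≡⟨ ℕ.*-identityˡ _ ⟩
    common (σ a) (σ b) (σ k)                                        ∎

-- Tables of rows, and sorting within classes of positions.

⟦_⟧ : ∀ {k n} → Vec (Vec Trit n) k → Pattern k n
⟦ R ⟧ a j = lookup (lookup R a) j

infix 4 _≟ᵗ_
_≟ᵗ_ : DecidableEquality Trit
⊕ ≟ᵗ ⊕ = yes refl
⊕ ≟ᵗ ⊖ = no λ ()
⊕ ≟ᵗ ⊙ = no λ ()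
⊖ ≟ᵗ ⊕ = no λ ()
⊖ ≟ᵗ ⊖ = yes refl
⊖ ≟ᵗ ⊙ = no λ ()
⊙ ≟ᵗ ⊕ = no λ ()
⊙ ≟ᵗ ⊖ = no λ ()
⊙ ≟ᵗ ⊙ = yes refl

infix 4 _≟ᶜ_
_≟ᶜ_ : ∀ {k} → DecidableEquality (Vec Trit k)
_≟ᶜ_ = ≡-dec _≟ᵗ_

rank : Trit → ℕ
rank ⊕ = 0
rank ⊖ = 1
rank ⊙ = 2

argmin : ∀ {n p} {P : Pred (Fin n) p} → Decidable P → (f : Fin n → ℕ) → ∀ i → P i →
         ∃ λ m → P m × (∀ j → P j → f m ≤ f j)
argmin {P = P} P? f i Pi = go i Pi (<-wellFounded (f i))
  where
  go : ∀ i → P i → Acc _<_ (f i) → ∃ λ m → P m × (∀ j → P j → f m ≤ f j)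
  go i Pi (acc rec) with Fin.any? (λ j → P? j ×-dec f j ℕ.<? f i)
  ... | yes (j , Pj , lt) = go j Pj (rec lt)
  ... | no none           = i , Pi , λ j Pj → ℕ.≮⇒≥ (λ lt → none (j , Pj , lt))

abstract
  -- Selection sort inside each class of equal keys: a transposition brings the least element of the
  -- class of position 0 to the front, and the tail is sorted recursively. The transposition stays
  -- within one class, so every position retains its key and the recursive call may use the original
  -- keys.
  classSort : ∀ {K : Set} → DecidableEquality K → ∀ {n} (κ : Fin n → K) (f : Fin n → ℕ) →
              ∃ λ (σ : Fin n → Fin n) → Injective _≡_ _≡_ σ × (∀ j → κ (σ j) ≡ κ j) ×
                (∀ {i j} → i Fin.< j → κ i ≡ κ j → f (σ i) ≤ f (σ j))
  classSort _≟_ {zero}  κ f = (λ ()) , (λ { {()} }) , (λ ()) , λ { {()} }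
  classSort _≟_ {suc n} κ f
    with argmin (λ j → κ j ≟ κ zero) f zero refl
  ... | m , κm≡κ0 , least
    with classSort _≟_ (κ ∘ suc) (f ∘ (transpose zero m ⟨$⟩ʳ_) ∘ suc)
  ... | σ′ , σ′-inj , σ′-class , σ′-sorted = σ , σ-inj , σ-class , σ-sorted
    where
    swap : Fin (suc n) → Fin (suc n)
    swap = transpose zero m ⟨$⟩ʳ_

    swap-class : ∀ j → κ (swap j) ≡ κ j
    swap-class j with j Fin.≟ zero
    ... | yes refl = κm≡κ0
    ... | no _ with j Fin.≟ m
    ...   | yes refl = sym κm≡κ0
    ...   | no _     = refl

    σ : Fin (suc n) → Fin (suc n)
    σ zero    = swap zero
    σ (suc j) = swap (suc (σ′ j))

    σ-inj : Injective _≡_ _≡_ σ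
    σ-inj {i} {j} eq = lift-inj i j (Injection.injective (↔⇒↣ (transpose zero m)) (trans (sym (unfold i)) (trans eq (unfold j))))
      where
      lift : Fin (suc n) → Fin (suc n)
      lift zero    = zero
      lift (suc j) = suc (σ′ j)

      unfold : ∀ j → σ j ≡ swap (lift j)
      unfold zero    = refl
      unfold (suc j) = refl

      lift-inj : ∀ i j → lift i ≡ lift j → i ≡ j
      lift-inj zero    zero    _  = refl
      lift-inj (suc i) (suc j) eq = cong suc (σ′-inj (Fin.suc-injective eq))

    σ-class : ∀ j → κ (σ j) ≡ κ j
    σ-class zero    = swap-class zero
    σ-class (suc j) = trans (swap-class (suc (σ′ j))) (σ′-class j)

    σ-sorted : ∀ {i j} → i Fin.< j → κ i ≡ κ j → f (σ i) ≤ f (σ j)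
    σ-sorted {zero}  {suc j} _         eq = least _ (trans (σ-class (suc j)) (sym eq))
    σ-sorted {suc i} {suc j} (s≤s i<j) eq = σ′-sorted i<j eq

-- For entries of a row r and a candidate row v, cost r v = r² − r v. Orthogonality of v to a row r
-- of norm 8 says exactly that the costs of v and of −v both add up to 8; as costs are nonnegative,
-- a search may abandon a partial row as soon as one of the two budgets of 8 is exceeded.
cost : Trit → Trit → ℕ
cost ⊙ _ = 0
cost _ ⊙ = 1
cost ⊕ ⊕ = 0
cost ⊕ ⊖ = 2
cost ⊖ ⊖ = 0
cost ⊖ ⊕ = 2

cost-val : ∀ r v → + cost r v ℤ.+ val r ℤ.* val v ≡ val r ℤ.* val r
cost-val ⊕ ⊕ = refl
cost-val ⊕ ⊖ = refl
cost-val ⊕ ⊙ = refl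
cost-val ⊖ ⊕ = refl
cost-val ⊖ ⊖ = refl
cost-val ⊖ ⊙ = refl
cost-val ⊙ v = refl

cost-val⁻ : ∀ r v → + cost r (minus ▹ v) ≡ val r ℤ.* val r ℤ.+ val r ℤ.* val v
cost-val⁻ ⊕ ⊕ = refl
cost-val⁻ ⊕ ⊖ = refl
cost-val⁻ ⊕ ⊙ = refl
cost-val⁻ ⊖ ⊕ = refl
cost-val⁻ ⊖ ⊖ = refl
cost-val⁻ ⊖ ⊙ = refl
cost-val⁻ ⊙ v = refl

-- Pruned enumeration of the rows orthogonal to a configuration.

data Budget (n : ℕ) : Set where
  budget : Vec Trit n → ℕ → ℕ → Budget n

Affordable : ∀ {n} → Vec Trit n → Budget n → Set
Affordable v (budget r p m) =
  ∑ℕ (λ j → cost (lookup r j) (lookup v j)) ≤ p × ∑ℕ (λ j → cost (lookup r j) (minus ▹ lookup v j)) ≤ m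

orthogonal⇒affordable : ∀ {n q} (r v : Vec Trit n) → dot (lookup r) (lookup r) ≡ + q →
                        dot (lookup r) (lookup v) ≡ 0ℤ → Affordable v (budget r q q)
orthogonal⇒affordable {n} {q} r v norm orth =
  ℕ.≤-reflexive (ℤ.+-injective (begin
    + ∑ℕ c⁺                        ≡⟨ ℤ.+-identityʳ (+ ∑ℕ c⁺) ⟨
    + ∑ℕ c⁺ ℤ.+ 0ℤ                 ≡⟨ cong₂ ℤ._+_ (∑-pos c⁺) (sym orth) ⟩
    ∑ (λ j → + c⁺ j) ℤ.+ ∑ rv      ≡⟨ ∑-+ (λ j → + c⁺ j) rv ⟨
    ∑ (λ j → + c⁺ j ℤ.+ rv j)      ≡⟨ ∑-cong (λ j → cost-val (lookup r j) (lookup v j)) ⟩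
    ∑ rr                           ≡⟨ norm ⟩
    + q                            ∎)) ,
  ℕ.≤-reflexive (ℤ.+-injective (begin
    + ∑ℕ c⁻                        ≡⟨ ∑-pos c⁻ ⟩
    ∑ (λ j → + c⁻ j)               ≡⟨ ∑-cong (λ j → cost-val⁻ (lookup r j) (lookup v j)) ⟩
    ∑ (λ j → rr j ℤ.+ rv j)        ≡⟨ ∑-+ rr rv ⟩
    ∑ rr ℤ.+ ∑ rv                  ≡⟨ cong₂ ℤ._+_ norm orth ⟩
    + q ℤ.+ 0ℤ                     ≡⟨ ℤ.+-identityʳ (+ q) ⟩
    + q                            ∎))
  where
  open ≡-Reasoning
  c⁺ c⁻ : Fin n → ℕ
  c⁺ j = cost (lookup r j) (lookup v j)
  c⁻ j = cost (lookup r j) (minus ▹ lookup v j)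
  rr rv : Fin n → ℤ
  rr j = val (lookup r j) ℤ.* val (lookup r j)
  rv j = val (lookup r j) ℤ.* val (lookup v j)

spend : ∀ {n} → Trit → Budget (suc n) → Maybe (Budget n)
spend x (budget (⊙ ∷ r) p m)             = just (budget r p m)
spend ⊙ (budget (_ ∷ r) (suc p) (suc m)) = just (budget r p m)
spend ⊕ (budget (⊕ ∷ r) p (suc (suc m))) = just (budget r p m)
spend ⊖ (budget (⊖ ∷ r) p (suc (suc m))) = just (budget r p m)
spend ⊖ (budget (⊕ ∷ r) (suc (suc p)) m) = just (budget r p m)
spend ⊕ (budget (⊖ ∷ r) (suc (suc p)) m) = just (budget r p m)
spend _ _                                = nothing

spend-complete : ∀ {n} x (v : Vec Trit n) b → Affordable (x ∷ v) b → ∃ λ b′ → spend x b ≡ just b′ × Affordable v b′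
spend-complete x v (budget (⊙ ∷ r) p m) aff = _ , refl , aff
spend-complete ⊙ v (budget (⊕ ∷ r) _ _) (s≤s p , s≤s m) = _ , refl , p , m
spend-complete ⊙ v (budget (⊖ ∷ r) _ _) (s≤s p , s≤s m) = _ , refl , p , m
spend-complete ⊕ v (budget (⊕ ∷ r) _ _) (p , s≤s (s≤s m)) = _ , refl , p , m
spend-complete ⊖ v (budget (⊖ ∷ r) _ _) (p , s≤s (s≤s m)) = _ , refl , p , m
spend-complete ⊖ v (budget (⊕ ∷ r) _ _) (s≤s (s≤s p) , m) = _ , refl , p , m
spend-complete ⊕ v (budget (⊖ ∷ r) _ _) (s≤s (s≤s p) , m) = _ , refl , p , m

spendAll : ∀ {n k} → Trit → Vec (Budget (suc n)) k → Maybe (Vec (Budget n) k)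
spendAll x []       = just []
spendAll x (b ∷ bs) = Maybe.zipWith _∷_ (spend x b) (spendAll x bs)

spendAll-complete : ∀ {n k} x (v : Vec Trit n) (bs : Vec _ k) → All (Affordable (x ∷ v)) bs →
                    ∃ λ bs′ → spendAll x bs ≡ just bs′ × All (Affordable v) bs′
spendAll-complete x v []       []           = [] , refl , []
spendAll-complete x v (b ∷ bs) (aff ∷ affs) with spend-complete x v b aff | spendAll-complete x v bs affs
... | b′ , eq , aff′ | bs′ , eqs , affs′ rewrite eq | eqs = b′ ∷ bs′ , refl , aff′ ∷ affs′

pay : Trit → ℕ → ℕ → Maybe (ℕ × ℕ)
pay ⊕ (suc w) z = just (w , z)
pay ⊖ (suc w) z = just (w , z)
pay ⊙ w (suc z) = just (w , z)
pay _ _ _       = nothing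

pay-complete : ∀ x {w z m n} → tally false x + m ≤ w → tally true x + n ≤ z →
               ∃₂ λ w′ z′ → pay x w z ≡ just (w′ , z′) × m ≤ w′ × n ≤ z′
pay-complete ⊕ (s≤s m≤w) n≤z = _ , _ , refl , m≤w , n≤z
pay-complete ⊖ (s≤s m≤w) n≤z = _ , _ , refl , m≤w , n≤z
pay-complete ⊙ m≤w (s≤s n≤z) = _ , _ , refl , m≤w , n≤z

-- (column equal to the previous one , zero column)
Mark : Set
Mark = Bool × Bool

nonminus : Trit → Bool
nonminus ⊖ = false
nonminus _ = true

admits : Mark → Trit → Trit → Bool
admits (same , null) p x = (if same then rank p ≤ᵇ rank x else true) ∧ (if null then nonminus x else true)

Admissible : ∀ {n} → Vec Mark n → Trit → Vec Trit n → Set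
Admissible []       p []      = ⊤
Admissible (μ ∷ μs) p (x ∷ v) = T (admits μ p x) × Admissible μs x v

-- `p` is the previous entry; `w` and `z` are the numbers of nonzero and zero entries still to be
-- placed. The outcomes of the tests are arguments of `extend` and `resume`, which lets the
-- completeness proof replace them by their known values.
search : ∀ {n k} → Vec Mark n → Trit → ℕ → ℕ → Vec (Budget n) k → List (Vec Trit n)
extend : ∀ {n k} → Vec Mark n → Trit → ℕ → ℕ → Vec (Budget (suc n)) k → Bool → List (Vec Trit (suc n))
resume : ∀ {n k} → Vec Mark n → Trit → Maybe (ℕ × ℕ) → Maybe (Vec (Budget n) k) → List (Vec Trit n)

-- No final test is called for. With `q ≤ n`, `w + z` starts at the length of the row and drops by
-- one per entry; for a row of norm `q`, its two budgets start at `2 q` together and drop by two per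
-- nonzero entry of that row. All of them are exactly used up here.
search []       p w z bs = [] ∷ []
search (μ ∷ μs) p w z bs =
  extend μs ⊕ w z bs (admits μ p ⊕) ++ extend μs ⊖ w z bs (admits μ p ⊖) ++ extend μs ⊙ w z bs (admits μ p ⊙)

extend μs x w z bs false = []
extend μs x w z bs true  = List.map (x ∷_) (resume μs x (pay x w z) (spendAll x bs))

resume μs x (just (w , z)) (just bs) = search μs x w z bs
resume μs x _              _         = []

search-complete : ∀ {n k} (μs : Vec Mark n) p {w z} (bs : Vec (Budget n) k) (v : Vec Trit n) →
                  Admissible μs p v → ∑ℕ (tally false ∘ lookup v) ≤ w → ∑ℕ (tally true ∘ lookup v) ≤ z →
                  All (Affordable v) bs → v ∈ search μs p w z bs
extend-complete : ∀ {n k} (μs : Vec Mark n) x {w z} (bs : Vec (Budget (suc n)) k) (v : Vec Trit n) {b} →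
                  T b → Admissible μs x v →
                  ∑ℕ (tally false ∘ lookup (x ∷ v)) ≤ w → ∑ℕ (tally true ∘ lookup (x ∷ v)) ≤ z →
                  All (Affordable (x ∷ v)) bs → x ∷ v ∈ extend μs x w z bs b

search-complete []       p bs []      _            _   _   _   = here refl
search-complete (μ ∷ μs) p {w} {z} bs (x ∷ v) (adm , adms) v≤w v≤z aff =
  choose x (extend-complete μs x bs v adm adms v≤w v≤z aff)
  where
  choose : ∀ x {v} → v ∈ extend μs x w z bs (admits μ p x) → v ∈ search (μ ∷ μs) p w z bs
  choose ⊕ v∈ = ∈-++⁺ˡ v∈
  choose ⊖ v∈ = ∈-++⁺ʳ (extend μs ⊕ w z bs (admits μ p ⊕)) (∈-++⁺ˡ v∈)
  choose ⊙ v∈ = ∈-++⁺ʳ (extend μs ⊕ w z bs (admits μ p ⊕)) (∈-++⁺ʳ (extend μs ⊖ w z bs (admits μ p ⊖)) v∈)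

extend-complete μs x bs v {true} _ adms v≤w v≤z aff
  with pay-complete x v≤w v≤z | spendAll-complete x v bs aff
... | w′ , z′ , eq , v≤w′ , v≤z′ | bs′ , eqs , aff′ rewrite eq | eqs =
  ∈-map⁺ (x ∷_) (search-complete μs x bs′ v adms v≤w′ v≤z′ aff′)

-- Only neighbouring columns are compared. Equal columns that are not adjacent lose some pruning,
-- but no candidate.
marks : ∀ {n k} → Vec Trit k → (Fin n → Vec Trit k) → Vec Mark n
marks {zero}      c κ = []
marks {suc n} {k} c κ = (does (c ≟ᶜ κ zero) , does (κ zero ≟ᶜ replicate k ⊙)) ∷ marks (κ zero) (κ ∘ suc)

admissible : ∀ {n k} (c : Vec Trit k) p (κ : Fin n → Vec Trit k) (y : Fin n → Trit) →
             (∀ j → c ≡ κ j → rank p ≤ rank (y j)) →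
             (∀ {i j} → i Fin.< j → κ i ≡ κ j → rank (y i) ≤ rank (y j)) →
             (∀ j → κ j ≡ replicate k ⊙ → y j ≢ ⊖) →
             Admissible (marks c κ) p (tabulate y)
admissible {zero}      c p κ y first sorted nonneg = tt
admissible {suc n} {k} c p κ y first sorted nonneg =
  from T-∧ (ordered , signed) ,
  admissible (κ zero) (y zero) (κ ∘ suc) (y ∘ suc) (λ j → sorted (s≤s z≤n)) (sorted ∘ s≤s) (nonneg ∘ suc)
  where
  open Equivalence
  ordered : T (if does (c ≟ᶜ κ zero) then rank p ≤ᵇ rank (y zero) else true)
  ordered with c ≟ᶜ κ zero
  ... | yes eq = ℕ.≤⇒≤ᵇ (first zero eq)
  ... | no _   = tt

  ≢⊖⇒nonminus : ∀ {x} → x ≢ ⊖ → T (nonminus x)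
  ≢⊖⇒nonminus {⊕} _   = tt
  ≢⊖⇒nonminus {⊖} x≢⊖ = contradiction refl x≢⊖
  ≢⊖⇒nonminus {⊙} _   = tt

  signed : T (if does (κ zero ≟ᶜ replicate k ⊙) then nonminus (y zero) else true)
  signed with κ zero ≟ᶜ replicate k ⊙
  ... | yes eq = ≢⊖⇒nonminus (nonneg zero eq)
  ... | no _   = tt

-- Extending a configuration inside a weighing matrix.

column : ∀ {n k} → Vec (Vec Trit n) k → Fin n → Vec Trit k
column R j = Vec.map (λ r → lookup r j) R

column-entry : ∀ {n k} (R : Vec (Vec Trit n) k) a j → lookup (column R j) a ≡ ⟦ R ⟧ a j
column-entry R a j = lookup-map a (λ r → lookup r j) R

column≡⇒≡ : ∀ {n k} (R : Vec (Vec Trit n) k) {i j} → column R i ≡ column R j → ∀ a → ⟦ R ⟧ a i ≡ ⟦ R ⟧ a j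
column≡⇒≡ R {i} {j} eq a = trans (sym (column-entry R a i)) (trans (cong (λ c → lookup c a) eq) (column-entry R a j))

goal : Bool → Trit
goal true  = ⊙
goal false = ⊕

-- Sorting along equal columns may carry the wanted entry away from `j`; it stays among the columns
-- equal to column `j`, hence the extra index `i`.
Hits : ∀ {n k} → Vec (Vec Trit n) k → Fin n → Bool → Vec Trit n → Set
Hits R j b v = ∃ λ i → lookup v i ≡ goal b × column R i ≡ column R j

hits? : ∀ {n k} (R : Vec (Vec Trit n) k) j b → Decidable (Hits R j b)
hits? R j b v = Fin.any? (λ i → (lookup v i ≟ᵗ goal b) ×-dec (column R i ≟ᶜ column R j))

-- Permuting equal columns of R and negating zero columns of R does not change R, so it suffices to
-- consider rows that are sorted along equal columns and have no ⊖ in zero columns.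
candidates : ∀ {n k} → ℕ → Vec (Vec Trit n) k → Fin n → Bool → List (Vec Trit n)
candidates {n} {k} q R j b =
  List.filter (hits? R j b) (search (marks (replicate k ⊙) (column R)) ⊕ q (n ∸ q) (Vec.map (λ r → budget r q q) R))

tally-▹ : ∀ b s x → tally b (s ▹ x) ≡ tally b x
tally-▹ b     plus  x = refl
tally-▹ true  minus ⊕ = refl
tally-▹ true  minus ⊖ = refl
tally-▹ true  minus ⊙ = refl
tally-▹ false minus ⊕ = refl
tally-▹ false minus ⊖ = refl
tally-▹ false minus ⊙ = refl

normalize : ∀ b x → tally b x ≢ 0 → ∃ λ s → s ▹ x ≡ goal b
normalize true  ⊕ ≢0 = contradiction refl ≢0
normalize true  ⊖ ≢0 = contradiction refl ≢0
normalize true  ⊙ ≢0 = plus , refl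
normalize false ⊕ ≢0 = plus , refl
normalize false ⊖ ≢0 = minus , refl
normalize false ⊙ ≢0 = contradiction refl ≢0

-- A column sign can be flipped without changing the rows already there exactly when the column is
-- zero; in that case `⊖` is turned into `⊕`. The goals `⊕` and `⊙` are never affected.
rectify : ∀ {k} (c : Vec Trit k) x b → ∃ λ t → (c ≡ replicate k ⊙ → t ▹ x ≢ ⊖) ×
          (∀ a → t ▹ lookup c a ≡ lookup c a) × (x ≡ goal b → t ▹ x ≡ goal b)
rectify c ⊕ b = plus , (λ _ ()) , (λ _ → refl) , id
rectify c ⊙ b = plus , (λ _ ()) , (λ _ → refl) , id
rectify {k} c ⊖ b with c ≟ᶜ replicate k ⊙
... | no c≢0   = plus , (λ c≡0 → contradiction c≡0 c≢0) , (λ _ → refl) , id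
... | yes refl = minus , (λ _ ()) , (λ a → subst (λ x → minus ▹ x ≡ x) (sym (lookup-replicate a ⊙)) refl) ,
                 (λ ⊖≡ → contradiction ⊖≡ (⊖≢goal b))
  where
  ⊖≢goal : ∀ b → ⊖ ≢ goal b
  ⊖≢goal true  ()
  ⊖≢goal false ()

-- The signs `t₁` and the permutation `σ` both preserve `R`. Row `i₀` of `W` can therefore be
-- normalized by them while the old rows keep an embedding with the same row map.
module Augment {n k q} (R : Vec (Vec Trit n) k) {W : Pattern n n} (W-orth : Orthogonal q W) (R⊑W : ⟦ R ⟧ ⊑ W)
               {i₀ : Fin n} (new : ∀ a → _⊑_.ρ R⊑W a ≢ i₀) (s₀ : Signum)
               (t₁ : Fin n → Signum) (fixed : ∀ j a → t₁ j ▹ ⟦ R ⟧ a j ≡ ⟦ R ⟧ a j)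
               (y : Fin n → Trit) (y-def : ∀ j → y j ≡ t₁ j ▹ s₀ ▹ _⊑_.t R⊑W j ▹ W i₀ (_⊑_.τ R⊑W j))
               {σ : Fin n → Fin n} (σ-inj : Injective _≡_ _≡_ σ) (σ-class : ∀ j → column R (σ j) ≡ column R j) where
  open _⊑_ R⊑W

  v : Vec Trit n
  v = tabulate (y ∘ σ)

  augmented : ⟦ v ∷ R ⟧ ⊑ W
  augmented = embedding ρ′ ρ′-inj s′ (τ ∘ σ) (σ-inj ∘ τ-inj) (λ j → t₁ (σ j) ⋆ t (σ j)) agrees′
    where
    ρ′ : Fin (suc k) → Fin n
    ρ′ zero    = i₀
    ρ′ (suc a) = ρ a

    ρ′-inj : Injective _≡_ _≡_ ρ′
    ρ′-inj {zero}  {zero}  _  = refl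
    ρ′-inj {zero}  {suc a} eq = contradiction (sym eq) (new a)
    ρ′-inj {suc a} {zero}  eq = contradiction eq (new a)
    ρ′-inj {suc a} {suc _} eq = cong suc (ρ-inj eq)

    s′ : Fin (suc k) → Signum
    s′ zero    = s₀
    s′ (suc a) = s a

    regroup : ∀ t₁ s t x → t₁ ▹ s ▹ t ▹ x ≡ s ▹ (t₁ ⋆ t) ▹ x
    regroup t₁ s t x = trans (▹-comm t₁ s (t ▹ x)) (cong (s ▹_) (sym (▹-⋆ t₁ t x)))

    agrees′ : ∀ a j → ⟦ v ∷ R ⟧ a j ≡ s′ a ▹ (t₁ (σ j) ⋆ t (σ j)) ▹ W (ρ′ a) (τ (σ j))
    agrees′ zero    j = trans (lookup∘tabulate (y ∘ σ) j)
      (trans (y-def (σ j)) (regroup (t₁ (σ j)) s₀ (t (σ j)) (W i₀ (τ (σ j)))))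
    agrees′ (suc a) j = begin
      ⟦ R ⟧ a j                                       ≡⟨ column≡⇒≡ R (σ-class j) a ⟨
      ⟦ R ⟧ a (σ j)                                   ≡⟨ fixed (σ j) a ⟨
      t₁ (σ j) ▹ ⟦ R ⟧ a (σ j)                        ≡⟨ cong (t₁ (σ j) ▹_) (agrees a (σ j)) ⟩
      t₁ (σ j) ▹ s a ▹ t (σ j) ▹ W (ρ a) (τ (σ j))    ≡⟨ regroup (t₁ (σ j)) (s a) (t (σ j)) (W (ρ a) (τ (σ j))) ⟩
      s a ▹ (t₁ (σ j) ⋆ t (σ j)) ▹ W (ρ a) (τ (σ j))  ∎
      where open ≡-Reasoning

  -- The weight of `v` and its orthogonality to `R` are inherited from `W` along `augmented`; order
  -- and signs are those of the normal form; the goal entry sits at the preimage of `j₀` under `σ`.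
  v∈candidates : ∀ {j₀ b} → y j₀ ≡ goal b →
                 (∀ {i j} → i Fin.< j → column R i ≡ column R j → rank (y (σ i)) ≤ rank (y (σ j))) →
                 (∀ j → column R j ≡ replicate k ⊙ → y j ≢ ⊖) →
                 v ∈ candidates q R j₀ b
  v∈candidates {j₀} {b} hits-goal sorted nonneg = ∈-filter⁺ (hits? R j₀ b)
    (search-complete (marks (replicate k ⊙) (column R)) ⊕ (Vec.map (λ r → budget r q q) R) v
      -- A zero column with entry `⊕` stands in for the missing predecessor of the first column; as
      -- `⊕` has rank 0, it imposes no condition.
      (admissible (replicate k ⊙) ⊕ (column R) (y ∘ σ) (λ _ _ → z≤n) sorted
        (λ j ≡0 → nonneg (σ j) (trans (σ-class j) ≡0)))
      (ℕ.≤-reflexive (tallies false)) (ℕ.≤-reflexive (tallies true))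
      (All.map⁺ (All.lookup⁻ affordable)))
    (hit , trans (lookup∘tabulate (y ∘ σ) hit) (trans (cong y σhit) hits-goal) ,
      trans (sym (σ-class hit)) (cong (column R) σhit))
    where
    vR-orth : Orthogonal q ⟦ v ∷ R ⟧
    vR-orth = ⊑-orthogonal augmented W-orth

    tallies : ∀ b → ∑ℕ (tally b ∘ lookup v) ≡ quota n q b
    tallies = tally-quota (lookup v) (row-weight vR-orth zero)

    affordable : ∀ a → Affordable v (budget (lookup R a) q q)
    affordable a = orthogonal⇒affordable (lookup R a) v (norm vR-orth (suc a)) (orth vR-orth {suc a} {zero} λ ())

    hit : Fin n
    hit = proj₁ (injective⇒surjective σ-inj j₀)

    σhit : σ hit ≡ j₀
    σhit = proj₂ (injective⇒surjective σ-inj j₀)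

-- Tallies ignore signs, and by `column-weight` every column of `W` has tally `quota n q b`. The
-- rows `ρ a` thus fall short of it in column `τ j₀`, and `fresh` yields another row `i₀`. The sign
-- `s₀` turns its entry there into `goal b`, which `rectify` then preserves.
augment : ∀ {n k q} (R : Vec (Vec Trit n) k) j₀ b → ∑ℕ (λ a → tally b (⟦ R ⟧ a j₀)) < quota n q b →
          {W : Pattern n n} → Orthogonal q W → ⟦ R ⟧ ⊑ W →
          ∃ λ v → v ∈ candidates q R j₀ b × ⟦ v ∷ R ⟧ ⊑ W
augment {n} {k} {q} R j₀ b room {W} W-orth R⊑W
  with fresh (λ i → tally b (W i (τ j₀))) ρ enough
  where
  open _⊑_ R⊑W
  enough : ∑ℕ (λ a → tally b (W (ρ a) (τ j₀))) < ∑ℕ (λ i → tally b (W i (τ j₀)))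
  enough = subst₂ _<_
    (∑ℕ-cong (λ a → trans (cong (tally b) (agrees a j₀))
      (trans (tally-▹ b (s a) (t j₀ ▹ W (ρ a) (τ j₀))) (tally-▹ b (t j₀) (W (ρ a) (τ j₀))))))
    (sym (tally-quota (λ i → W i (τ j₀)) (column-weight W-orth (τ j₀)) b))
    room
... | i₀ , new , ≢0
  with normalize b (t j₀ ▹ W i₀ (τ j₀)) (subst (_≢ 0) (sym (tally-▹ b (t j₀) (W i₀ (τ j₀)))) ≢0)
  where open _⊑_ R⊑W
... | s₀ , signed = v , v∈candidates (proj₂ (proj₂ (proj₂ (rectified j₀))) signed) σ-sorted (λ j → proj₁ (proj₂ (rectified j))) , augmented
  where
  open _⊑_ R⊑W

  u : Fin n → Trit
  u j = s₀ ▹ t j ▹ W i₀ (τ j)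

  rectified : ∀ j → _
  rectified j = rectify (column R j) (u j) b

  t₁ : Fin n → Signum
  t₁ j = proj₁ (rectified j)

  fixed : ∀ j a → t₁ j ▹ ⟦ R ⟧ a j ≡ ⟦ R ⟧ a j
  fixed j a = subst (λ x → t₁ j ▹ x ≡ x) (column-entry R a j) (proj₁ (proj₂ (proj₂ (rectified j))) a)

  y : Fin n → Trit
  y j = t₁ j ▹ u j

  sorting = classSort _≟ᶜ_ (column R) (rank ∘ y)

  σ-sorted = proj₂ (proj₂ (proj₂ sorting))

  open Augment R W-orth R⊑W new s₀ t₁ fixed y (λ _ → refl) (proj₁ (proj₂ sorting)) (proj₁ (proj₂ (proj₂ sorting)))

-- Certificates and their verification.

distinct? : ∀ {k l} (ρ : Fin k → Fin l) → Dec (∀ i j → ρ i ≡ ρ j → i ≡ j)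
distinct? ρ = Fin.all? λ i → Fin.all? λ j → (ρ i Fin.≟ ρ j) →-dec (i Fin.≟ j)

Embeds : ∀ {k l n} → Vec (Vec Trit n) k → Vec (Vec Trit n) l → Vec (Signum × Fin l) k → Vec (Signum × Fin n) n → Set
Embeds G H rs cs =
  (∀ i j → proj₂ (lookup rs i) ≡ proj₂ (lookup rs j) → i ≡ j) ×
  (∀ i j → proj₂ (lookup cs i) ≡ proj₂ (lookup cs j) → i ≡ j) ×
  (∀ a j → ⟦ G ⟧ a j ≡ proj₁ (lookup rs a) ▹ proj₁ (lookup cs j) ▹ ⟦ H ⟧ (proj₂ (lookup rs a)) (proj₂ (lookup cs j)))

embeds? : ∀ {k l n} (G : Vec (Vec Trit n) k) (H : Vec (Vec Trit n) l) rs cs → Dec (Embeds G H rs cs)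
embeds? G H rs cs = distinct? (proj₂ ∘ lookup rs) ×-dec distinct? (proj₂ ∘ lookup cs) ×-dec
  Fin.all? λ a → Fin.all? λ j → ⟦ G ⟧ a j ≟ᵗ _

Embeds⇒⊑ : ∀ {k l n} {G : Vec (Vec Trit n) k} {H : Vec (Vec Trit n) l} rs cs → Embeds G H rs cs → ⟦ G ⟧ ⊑ ⟦ H ⟧
Embeds⇒⊑ rs cs (rs-inj , cs-inj , agrees) =
  embedding (proj₂ ∘ lookup rs) (λ {i} {j} → rs-inj i j) (proj₁ ∘ lookup rs)
            (proj₂ ∘ lookup cs) (λ {i} {j} → cs-inj i j) (proj₁ ∘ lookup cs) agrees

-- A row is written as a decimal numeral, with digit 2 for the entry -1. The length is fixed by the
-- type, which restores leading zeros.
readRow : ∀ {n} → ℕ → Vec Trit n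
readRow = Vec.reverse ∘ digits _
  where
  trit : ℕ → Trit
  trit 0 = ⊙
  trit 1 = ⊕
  trit _ = ⊖

  digits : ∀ n → ℕ → Vec Trit n
  digits zero    c = []
  digits (suc n) c = trit (c % 10) ∷ digits n (c / 10)

readRows : ∀ {n k} → Vec ℕ k → Vec (Vec Trit n) k
readRows = Vec.map readRow

-- Mixed radix, least significant first: sign bit, index, sign bit, index, ...
readPermutation : ∀ n {m} → ℕ → Vec (Signum × Fin (suc m)) n
readPermutation zero        c = []
readPermutation (suc n) {m} c = (bit (c % 2) , (c / 2) mod suc m) ∷ readPermutation n (c / 2 / suc m)
  where
  bit : ℕ → Signum
  bit zero    = plus
  bit (suc _) = minus

-- refer g p q: the g-th most recent configuration embeds by the row map p and the column map q.
-- split rows j b cs: branch on a further row that is zero (b = true) or nonzero (b = false) in column j;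
-- the i-th element of cs refers the i-th candidate for this row to an earlier configuration.
data Reference : Set where
  refer : ℕ → ℕ → ℕ → Reference

data Branching : Set where
  split : ∀ {k} → Vec ℕ k → ℕ → Bool → List Reference → Branching

Configuration : ℕ → Set
Configuration n = ∃ λ k → Vec (Vec Trit n) k

refers : ∀ {n k} → List (Configuration (suc n)) → Reference → Vec (Vec Trit (suc n)) (suc k) → Bool
refers []              _                   H = false
refers ((k , G) ∷ gs)  (refer zero p q)    H = ⌊ embeds? G H (readPermutation k p) (readPermutation _ q) ⌋
refers (_ ∷ gs)        (refer (suc g) p q) H = refers gs (refer g p q) H

covers : ∀ {n k} → List (Configuration (suc n)) → Vec (Vec Trit (suc n)) k → List (Vec Trit (suc n)) → List Reference → Bool
covers gs R []       _        = true
covers gs R (v ∷ vs) []       = false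
covers gs R (v ∷ vs) (c ∷ cs) = refers gs c (v ∷ R) ∧ covers gs R vs cs

reduces : ∀ {n k} → ℕ → List (Configuration (suc n)) → Vec (Vec Trit (suc n)) k → Fin (suc n) → Bool → List Reference → Bool
reduces {n} q gs R j b cs = (∑ℕ (λ a → tally b (⟦ R ⟧ a j)) <ᵇ quota (suc n) q b) ∧ covers gs R (candidates q R j b) cs

check : ∀ {n} → ℕ → List (Configuration (suc n)) → List Branching → Bool
check q gs               (split rows j b cs ∷ bs) =
  reduces q gs (readRows rows) (j mod _) b cs ∧ check q ((_ , readRows rows) ∷ gs) bs
-- Acceptance requires that the configuration settled last has no rows: it embeds in every pattern,
-- so settling it classifies them all.
check _ ((zero , _) ∷ _) []                      = true
check _ _                []                      = false

-- `Classified` is arbitrary here; the representatives enter only through the starting list of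
-- settled configurations.
module Soundness {n q : ℕ} (Classified : Pattern (suc n) (suc n) → Set) where

  Settled : Configuration (suc n) → Set
  Settled (_ , R) = ∀ {W} → Orthogonal q W → ⟦ R ⟧ ⊑ W → Classified W

  -- By transitivity of `⊑`, whatever contains a settled configuration is settled; the configuration
  -- referred to may have fewer rows than `H`.
  refers-sound : ∀ {k} gs c (H : Vec (Vec Trit (suc n)) (suc k)) → ListAll.All Settled gs → T (refers gs c H) → Settled (_ , H)
  refers-sound ((k , G) ∷ gs) (refer zero p q) H (settled ∷ _) ok W-orth H⊑W =
    settled W-orth (⊑-trans (Embeds⇒⊑ {G = G} {H} rs cs (toWitness {a? = embeds? G H rs cs} ok)) H⊑W)
    where
    rs = readPermutation k p
    cs = readPermutation _ q
  refers-sound (_ ∷ gs) (refer (suc g) p q) H (_ ∷ settled) ok = refers-sound gs (refer g p q) H settled ok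

  covers-sound : ∀ {k} gs (R : Vec (Vec Trit (suc n)) k) vs cs → ListAll.All Settled gs → T (covers gs R vs cs) →
                 ∀ {v} → v ∈ vs → Settled (_ , v ∷ R)
  covers-sound gs R (v ∷ vs) (c ∷ cs) settled ok v∈ with Equivalence.to (T-∧ {refers gs c (v ∷ R)}) ok
  covers-sound gs R (v ∷ vs) (c ∷ cs) settled ok (here refl) | first , _ = refers-sound gs c (v ∷ R) settled first
  covers-sound gs R (v ∷ vs) (c ∷ cs) settled ok (there v∈)  | _ , rest  = covers-sound gs R vs cs settled rest v∈

  -- `augment` gives, for each `W`, one candidate `v` such that `W` contains `v ∷ R`. Which one it
  -- is depends on `W`, so every candidate has to be covered.
  reduces-sound : ∀ {k} gs (R : Vec (Vec Trit (suc n)) k) j b cs → ListAll.All Settled gs → T (reduces q gs R j b cs) → Settled (_ , R)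
  reduces-sound {k} gs R j b cs settled ok W-orth R⊑W =
    covers-sound gs R (candidates q R j b) cs settled (proj₂ both) (proj₁ (proj₂ augmented)) W-orth (proj₂ (proj₂ augmented))
    where
    both = Equivalence.to (T-∧ {∑ℕ (λ a → tally b (⟦ R ⟧ a j)) <ᵇ quota (suc n) q b}) ok
    augmented = augment R j b (ℕ.<ᵇ⇒< _ _ (proj₁ both)) W-orth R⊑W

  check-sound : ∀ gs bs → ListAll.All Settled gs → check q gs bs ≡ true → ∀ {W} → Orthogonal q W → Classified W
  check-sound gs (split rows j b cs ∷ bs) settled eq =
    check-sound _ bs (reduces-sound gs (readRows rows) (j mod _) b cs settled (proj₁ both) ∷ settled)
      (Equivalence.to T-≡ (proj₂ both))
    where both = Equivalence.to (T-∧ {reduces q gs (readRows rows) (j mod _) b cs}) (Equivalence.from T-≡ eq)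
  check-sound ((zero , []) ∷ _) [] (settled ∷ _) _ W-orth =
    settled W-orth (embedding (λ ()) (λ { {()} }) (λ ()) id id (λ _ → plus) λ ())

-- The seven representatives and the certificate.

representatives : Vec (Vec (Vec Trit 12) 12) 7
representatives = Vec.map readRows
  ((000012122121 ∷
    001222111020 ∷
    010122120012 ∷
    011021220120 ∷
    100122212001 ∷
    120021120201 ∷
    122100001122 ∷
    121200002112 ∷
    112200002222 ∷
    101012221200 ∷
    112200001111 ∷
    111111110000 ∷ []) ∷
   (000012122112 ∷
    000011222121 ∷
    010120022211 ∷
    010120021122 ∷
    101022212100 ∷
    121221120000 ∷
    122102100021 ∷
    122101200012 ∷
    112200002222 ∷
    101012221200 ∷
    112200001111 ∷
    111111110000 ∷ []) ∷
   (000012122112 ∷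
    000011222121 ∷
    010122120021 ∷
    010121220012 ∷
    101022212100 ∷
    121221120000 ∷
    122100002211 ∷
    122100001122 ∷
    112200002222 ∷
    101012221200 ∷
    112200001111 ∷
    111111110000 ∷ []) ∷
   (000012122112 ∷
    000011222121 ∷
    122210010022 ∷
    112120020022 ∷
    101022212100 ∷
    121221120000 ∷
    010202102221 ∷
    010201202212 ∷
    122100002211 ∷
    101012221200 ∷
    112200001111 ∷
    111111110000 ∷ []) ∷
   (010221120202 ∷
    010212210202 ∷
    020200111221 ∷
    010100221221 ∷
    102021212020 ∷
    121211220000 ∷
    122100001212 ∷
    102012122020 ∷
    101022002211 ∷
    101022001122 ∷
    112200001111 ∷
    111111110000 ∷ []) ∷
   (010100222112 ∷
    010100221221 ∷
    122121120000 ∷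
    122112210000 ∷
    121211220000 ∷
    112200002222 ∷
    000012122121 ∷
    000012121212 ∷
    101022002211 ∷
    101022001122 ∷
    112200001111 ∷
    111111110000 ∷ []) ∷
   (122100002112 ∷
    122100001221 ∷
    112200002222 ∷
    222211110000 ∷
    212112210000 ∷
    000012122121 ∷
    121212210000 ∷
    000012121212 ∷
    000011222211 ∷
    000011221122 ∷
    112200001111 ∷
    111111110000 ∷ []) ∷
   [])

spreads : Vec ℕ 7
spreads = 1664 ∷ 1504 ∷ 1472 ∷ 1632 ∷ 1440 ∷ 1344 ∷ 1152 ∷ []

-- Rows are listed latest first, as in `v ∷ R`; each representative without its first row is one of
-- the configurations. The recurring column code 34794433095978288 is the identity: the sum of
-- `2j * 24^j` over `j < 12`.
branchings : List Branching
branchings =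
  -- An empty list of references marks a dead end: there is no candidate, so no weighing matrix
  -- contains the configuration.
  split (121201202100 ∷ 112200002222 ∷ 101012221200 ∷ 112200001111 ∷ 111111110000 ∷ []) 10 true
    ([]) ∷
  split (122100002211 ∷ 122100001122 ∷ 121200002112 ∷ 112200002222 ∷ 101012221200 ∷ 112200001111 ∷ 111111110000 ∷ []) 0 false
    ([]) ∷
  split (001222111020 ∷ 010122120012 ∷ 011021220120 ∷ 100122212001 ∷ 120021120201 ∷ 122100001122 ∷ 121200002112 ∷ 112200002222 ∷ 101012221200 ∷ 112200001111 ∷ 111111110000 ∷ []) 4 false
    (refer 2 34794433095978288 34794433095978288 ∷ []) ∷
  split (010122120012 ∷ 011021220120 ∷ 100122212001 ∷ 120021120201 ∷ 122100001122 ∷ 121200002112 ∷ 112200002222 ∷ 101012221200 ∷ 112200001111 ∷ 111111110000 ∷ []) 2 false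
    (refer 0 553843650770828 34794433095978288 ∷ []) ∷
  split (011021220120 ∷ 100122212001 ∷ 120021120201 ∷ 122100001122 ∷ 121200002112 ∷ 112200002222 ∷ 101012221200 ∷ 112200001111 ∷ 111111110000 ∷ []) 1 false
    (refer 0 9644321329640 34794433095978288 ∷ []) ∷
  split (100122212001 ∷ 120021120201 ∷ 122100001122 ∷ 121200002112 ∷ 112200002222 ∷ 101012221200 ∷ 112200001111 ∷ 111111110000 ∷ []) 1 false
    (refer 0 185318368164 34794433095978288 ∷ refer 0 182536725960 30306084643587504 ∷ []) ∷
  split (120021120201 ∷ 122100001122 ∷ 121200002112 ∷ 112200002222 ∷ 101012221200 ∷ 112200001111 ∷ 111111110000 ∷ []) 0 false
    (refer 0 3970458656 34794433095978288 ∷ []) ∷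
  split (122100001122 ∷ 121200002112 ∷ 112200002222 ∷ 101012221200 ∷ 112200001111 ∷ 111111110000 ∷ []) 0 false
    (refer 5 96057276 34794433095978288 ∷ refer 0 96057276 34794433095978288 ∷
     refer 0 66081876 34763818996599936 ∷ []) ∷
  split (121200002112 ∷ 112200002222 ∷ 101012221200 ∷ 112200001111 ∷ 111111110000 ∷ []) 4 true
    (refer 0 2665176 34794433095978288 ∷ refer 0 2582808 33460650514107696 ∷
     refer 0 2603688 34794433095920788 ∷ refer 0 2686056 33460650514050196 ∷ []) ∷
  split (010121220021 ∷ 101022212100 ∷ 121221120000 ∷ 122102100021 ∷ 122101200012 ∷ 112200002222 ∷ 101012221200 ∷ 112200001111 ∷ 111111110000 ∷ []) 1 true
    ([]) ∷
  split (000011222121 ∷ 010120022211 ∷ 010120021122 ∷ 101022212100 ∷ 121221120000 ∷ 122102100021 ∷ 122101200012 ∷ 112200002222 ∷ 101012221200 ∷ 112200001111 ∷ 111111110000 ∷ []) 4 false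
    (refer 11 34794433095978288 34794433095978288 ∷ []) ∷
  split (010120022211 ∷ 010120021122 ∷ 101022212100 ∷ 121221120000 ∷ 122102100021 ∷ 122101200012 ∷ 112200002222 ∷ 101012221200 ∷ 112200001111 ∷ 111111110000 ∷ []) 4 false
    (refer 0 553843650770828 34794433095978288 ∷ refer 0 550234433440428 31877877205232788 ∷ []) ∷
  split (010120021122 ∷ 101022212100 ∷ 121221120000 ∷ 122102100021 ∷ 122101200012 ∷ 112200002222 ∷ 101012221200 ∷ 112200001111 ∷ 111111110000 ∷ []) 1 false
    (refer 0 9644321329640 34794433095978288 ∷ []) ∷
  split (101022212100 ∷ 121221120000 ∷ 122102100021 ∷ 122101200012 ∷ 112200002222 ∷ 101012221200 ∷ 112200001111 ∷ 111111110000 ∷ []) 1 false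
    (refer 3 185318368164 34794433095978288 ∷ refer 3 185932588572 36377205672176788 ∷
     refer 0 185318368164 34794433095978288 ∷ refer 0 182877046308 33460650514107696 ∷ []) ∷
  split (121221120000 ∷ 122102100021 ∷ 122101200012 ∷ 112200002222 ∷ 101012221200 ∷ 112200001111 ∷ 111111110000 ∷ []) 0 false
    (refer 0 3970458656 34794433095978288 ∷ []) ∷
  split (101022212100 ∷ 122102100021 ∷ 122101200012 ∷ 112200002222 ∷ 101012221200 ∷ 112200001111 ∷ 111111110000 ∷ []) 0 false
    (refer 0 247629376 34789342114688304 ∷ []) ∷
  split (122102100021 ∷ 122101200012 ∷ 112200002222 ∷ 101012221200 ∷ 112200001111 ∷ 111111110000 ∷ []) 0 false
    (refer 1 96057276 34794433095978288 ∷ refer 0 96057276 34794433095978288 ∷ []) ∷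
  split (122101200012 ∷ 112200002222 ∷ 101012221200 ∷ 112200001111 ∷ 111111110000 ∷ []) 4 true
    (refer 0 2665176 34794433095978288 ∷ refer 0 2686068 36377205672176788 ∷ []) ∷
  split (000011222121 ∷ 010122120021 ∷ 010121220012 ∷ 101022212100 ∷ 121221120000 ∷ 122100002211 ∷ 122100001122 ∷ 112200002222 ∷ 101012221200 ∷ 112200001111 ∷ 111111110000 ∷ []) 4 false
    (refer 20 34794433095978288 34794433095978288 ∷ []) ∷
  split (010122120021 ∷ 010121220012 ∷ 101022212100 ∷ 121221120000 ∷ 122100002211 ∷ 122100001122 ∷ 112200002222 ∷ 101012221200 ∷ 112200001111 ∷ 111111110000 ∷ []) 4 false
    (refer 0 553843650770828 34794433095978288 ∷ refer 0 235124580085318 31877854275214248 ∷ []) ∷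
  split (010121220012 ∷ 101022212100 ∷ 121221120000 ∷ 122100002211 ∷ 122100001122 ∷ 112200002222 ∷ 101012221200 ∷ 112200001111 ∷ 111111110000 ∷ []) 1 false
    (refer 0 9644321329640 34794433095978288 ∷ []) ∷
  split (101022212100 ∷ 121221120000 ∷ 122100002211 ∷ 122100001122 ∷ 112200002222 ∷ 101012221200 ∷ 112200001111 ∷ 111111110000 ∷ []) 1 false
    (refer 0 185318368164 34794433095978288 ∷ []) ∷
  split (121221120000 ∷ 122100002211 ∷ 122100001122 ∷ 112200002222 ∷ 101012221200 ∷ 112200001111 ∷ 111111110000 ∷ []) 0 false
    (refer 0 3970458656 34794433095978288 ∷ []) ∷
  split (121221000012 ∷ 122100002211 ∷ 122100001122 ∷ 112200002222 ∷ 101012221200 ∷ 112200001111 ∷ 111111110000 ∷ []) 10 true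
    ([]) ∷
  split (122100002211 ∷ 122100001122 ∷ 112200002222 ∷ 101012221200 ∷ 112200001111 ∷ 111111110000 ∷ []) 0 false
    (refer 1 96057276 34794433095978288 ∷ refer 0 96057276 34794433095978288 ∷
     refer 23 473564 36379517620057488 ∷ refer 15 473564 33462962095650192 ∷
     refer 1 66087700 34763818996599936 ∷ refer 0 66087700 34763836944354432 ∷ []) ∷
  split (010102202112 ∷ 122100001122 ∷ 112200002222 ∷ 101012221200 ∷ 112200001111 ∷ 111111110000 ∷ []) 10 true
    (refer 24 337176 34763836578073728 ∷ refer 24 375788 34751173497989621 ∷ []) ∷
  split (122100001122 ∷ 112200002222 ∷ 101012221200 ∷ 112200001111 ∷ 111111110000 ∷ []) 4 true
    (refer 25 139704 34763836578073728 ∷ refer 17 139704 34763836944354432 ∷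
     refer 1 2665176 34794433095978288 ∷ refer 1 2686068 36377206038457492 ∷
     refer 25 160584 34751173497989621 ∷ refer 17 160584 34751173497989621 ∷
     refer 0 2665176 34794433095978288 ∷ refer 0 2915736 34789374417351917 ∷ []) ∷
  split (010102202112 ∷ 112200002222 ∷ 101012221200 ∷ 112200001111 ∷ 111111110000 ∷ []) 10 true
    (refer 26 222096 34794433095978288 ∷ refer 26 242976 34789374051071213 ∷ []) ∷
  split (112200002222 ∷ 101012221200 ∷ 112200001111 ∷ 111111110000 ∷ []) 4 true
    (refer 27 86420 34794433095978288 ∷ refer 19 86420 34794433095978288 ∷ refer 10 86420 34794433095978288 ∷
     refer 1 86420 34794433095978288 ∷ refer 1 82460 36377206038514992 ∷ refer 10 87430 33460650514050196 ∷
     refer 1 83470 34794433095920788 ∷ refer 1 87430 36377206038457492 ∷ refer 27 96520 34789374051071213 ∷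
     refer 19 96520 34789374417351917 ∷ refer 0 86420 34794433095978288 ∷ refer 0 96520 34789374417351917 ∷
     []) ∷
  split (121201202100 ∷ 101012221200 ∷ 112200001111 ∷ 111111110000 ∷ []) 10 true
    ([]) ∷
  split (122100002211 ∷ 121200002112 ∷ 101012221200 ∷ 112200001111 ∷ 111111110000 ∷ []) 4 true
    (refer 1 18504 34794433095978288 ∷ refer 1 17640 34792121514325392 ∷ refer 1 17784 36379517620110388 ∷
     refer 1 18648 36377206038457492 ∷ []) ∷
  split (121200002112 ∷ 101012221200 ∷ 112200001111 ∷ 111111110000 ∷ []) 4 true
    (refer 2 8640 34794433095978288 ∷ refer 2 4680 34763836944354432 ∷ refer 0 86420 34794433095978288 ∷
     refer 0 87420 33460650514050196 ∷ refer 2 4780 36338794539540940 ∷ refer 2 8740 36377206038457492 ∷ []) ∷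
  split (121221120000 ∷ 122101200012 ∷ 101012221200 ∷ 112200001111 ∷ 111111110000 ∷ []) 10 true
    (refer 3 7872 23384506409674872 ∷ refer 3 8016 21921165183057653 ∷ []) ∷
  split (122101200012 ∷ 101012221200 ∷ 112200001111 ∷ 111111110000 ∷ []) 0 false
    (refer 4 8640 34794433095978288 ∷ refer 0 86420 34794433095978288 ∷ refer 0 24680 23384505860253816 ∷
     refer 4 2460 23384506409674872 ∷ []) ∷
  split (010102202112 ∷ 122100002211 ∷ 101012221200 ∷ 112200001111 ∷ 111111110000 ∷ []) 10 true
    (refer 4 17928 34792121514325392 ∷ refer 4 19668 34797189398432909 ∷ []) ∷
  split (000011222121 ∷ 122210010022 ∷ 112120020022 ∷ 101022212100 ∷ 121221120000 ∷ 010202102221 ∷ 010201202212 ∷ 122100002211 ∷ 101012221200 ∷ 112200001111 ∷ 111111110000 ∷ []) 4 false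
    (refer 38 34794433095978288 34794433095978288 ∷ []) ∷
  split (122210010022 ∷ 112120020022 ∷ 101022212100 ∷ 121221120000 ∷ 010202102221 ∷ 010201202212 ∷ 122100002211 ∷ 101012221200 ∷ 112200001111 ∷ 111111110000 ∷ []) 4 false
    (refer 0 553843650770828 34794433095978288 ∷ refer 0 549024669864748 31875565623637392 ∷ []) ∷
  split (112120020022 ∷ 101022212100 ∷ 121221120000 ∷ 010202102221 ∷ 010201202212 ∷ 122100002211 ∷ 101012221200 ∷ 112200001111 ∷ 111111110000 ∷ []) 0 false
    (refer 0 9644321329640 34794433095978288 ∷ []) ∷
  split (101022212100 ∷ 121221120000 ∷ 010202102221 ∷ 010201202212 ∷ 122100002211 ∷ 101012221200 ∷ 112200001111 ∷ 111111110000 ∷ []) 0 false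
    (refer 0 185318368164 34794433095978288 ∷ refer 0 53078845140 34794410165902248 ∷
     refer 0 28733649768 34753682132317848 ∷ refer 0 138933252288 34753709649128136 ∷ []) ∷
  split (121221120000 ∷ 010202102221 ∷ 010201202212 ∷ 122100002211 ∷ 101012221200 ∷ 112200001111 ∷ 111111110000 ∷ []) 10 true
    (refer 0 3970458656 34794433095978288 ∷ refer 0 3887388704 34852743154590492 ∷ []) ∷
  split (010202102221 ∷ 010201202212 ∷ 122100002211 ∷ 101012221200 ∷ 112200001111 ∷ 111111110000 ∷ []) 10 true
    (refer 0 96057276 34794433095978288 ∷ refer 0 66633364 33422238648852940 ∷
     refer 0 103625228 34789374051071213 ∷ refer 0 74201316 33429829426637017 ∷ []) ∷
  split (010201202212 ∷ 122100002211 ∷ 101012221200 ∷ 112200001111 ∷ 111111110000 ∷ []) 4 true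
    (refer 0 2665176 34794433095978288 ∷ refer 0 1676772 31847281419947136 ∷ []) ∷
  split (122100002211 ∷ 101012221200 ∷ 112200001111 ∷ 111111110000 ∷ []) 4 true
    (refer 13 8640 34794433095978288 ∷ refer 12 8240 34792121514325392 ∷ refer 10 8240 34792121514325392 ∷
     refer 13 8240 34792121514325392 ∷ refer 13 8340 36379517620110388 ∷ refer 12 9250 34797189398432909 ∷
     refer 10 9250 34797189764713613 ∷ refer 13 8740 36377206038457492 ∷ refer 7 86420 34794433095978288 ∷
     refer 0 86420 34794433095978288 ∷ refer 0 46820 34763836578073728 ∷ refer 7 96520 34789374417351917 ∷ []) ∷
  split (010102202112 ∷ 101012221200 ∷ 112200001111 ∷ 111111110000 ∷ []) 10 true
    (refer 13 8640 34794433095978288 ∷ refer 13 9650 34789374051071213 ∷ []) ∷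
  split (010201202212 ∷ 101012221200 ∷ 112200001111 ∷ 111111110000 ∷ []) 4 true
    (refer 1 8640 34794433095978288 ∷ refer 1 8740 36377206038457492 ∷ refer 1 9340 34857812137543571 ∷
     refer 1 9240 36313778318093173 ∷ []) ∷
  split (101012221200 ∷ 112200001111 ∷ 111111110000 ∷ []) 4 true
    (refer 16 3344 34794433095978288 ∷ refer 15 3344 34794433095978288 ∷ refer 13 3344 34794433095978288 ∷
     refer 11 3344 34794433095978288 ∷ refer 16 1328 34763836944354432 ∷ refer 2 3344 34794433095978288 ∷
     refer 11 1328 34763836578073728 ∷ refer 11 3408 33460650514050196 ∷ refer 2 3408 36377206038457492 ∷
     refer 16 1392 36338794539540940 ∷ refer 15 3864 34789374051071213 ∷ refer 13 3864 34789374417351917 ∷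
     refer 16 3408 36377206038457492 ∷ refer 11 1392 33422238648852940 ∷ refer 1 3344 34794433095978288 ∷
     refer 0 3344 34794433095978288 ∷ refer 0 3408 33460650514050196 ∷ refer 1 3864 34789374417351917 ∷ []) ∷
  split (010212210202 ∷ 020200111221 ∷ 010100221221 ∷ 102021212020 ∷ 121211220000 ∷ 122100001212 ∷ 102012122020 ∷ 101022002211 ∷ 101022001122 ∷ 112200001111 ∷ 111111110000 ∷ []) 1 false
    (refer 50 34794433095978288 34794433095978288 ∷ []) ∷
  split (020200111221 ∷ 010100221221 ∷ 102021212020 ∷ 121211220000 ∷ 122100001212 ∷ 102012122020 ∷ 101022002211 ∷ 101022001122 ∷ 112200001111 ∷ 111111110000 ∷ []) 1 false
    (refer 0 553843650770828 34794433095978288 ∷ refer 0 545392926019524 34604764523652148 ∷ []) ∷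
  split (010100221221 ∷ 102021212020 ∷ 121211220000 ∷ 122100001212 ∷ 102012122020 ∷ 101022002211 ∷ 101022001122 ∷ 112200001111 ∷ 111111110000 ∷ []) 8 false
    (refer 0 9644321329640 34794433095978288 ∷ []) ∷
  split (102021212020 ∷ 121211220000 ∷ 122100001212 ∷ 102012122020 ∷ 101022002211 ∷ 101022001122 ∷ 112200001111 ∷ 111111110000 ∷ []) 1 false
    (refer 0 185318368164 34794433095978288 ∷ refer 0 185254122852 28465102530858288 ∷
     refer 0 164352130668 21970256613901680 ∷ refer 0 164159394732 18805591331341680 ∷ []) ∷
  split (121211220000 ∷ 122100001212 ∷ 102012122020 ∷ 101022002211 ∷ 101022001122 ∷ 112200001111 ∷ 111111110000 ∷ []) 0 false
    (refer 0 3970458656 34794433095978288 ∷ []) ∷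
  split (102021212020 ∷ 122100001212 ∷ 102012122020 ∷ 101022002211 ∷ 101022001122 ∷ 112200001111 ∷ 111111110000 ∷ []) 0 false
    (refer 0 248152640 34794424289979696 ∷ []) ∷
  split (122100001212 ∷ 102012122020 ∷ 101022002211 ∷ 101022001122 ∷ 112200001111 ∷ 111111110000 ∷ []) 0 false
    (refer 1 96057276 34794433095978288 ∷ refer 0 96057276 34794433095978288 ∷ []) ∷
  split (102012122020 ∷ 101022002211 ∷ 101022001122 ∷ 112200001111 ∷ 111111110000 ∷ []) 6 true
    (refer 0 2665176 34794433095978288 ∷ refer 0 2685924 30052930131790996 ∷ []) ∷
  split (122112210000 ∷ 001210201212 ∷ 101022002211 ∷ 101022001122 ∷ 112200001111 ∷ 111111110000 ∷ []) 8 true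
    ([]) ∷
  split (001210201212 ∷ 101022002211 ∷ 101022001122 ∷ 112200001111 ∷ 111111110000 ∷ []) 8 true
    (refer 0 2665176 34794433095978288 ∷ refer 0 2936628 36382274288850313 ∷ []) ∷
  split (010100221221 ∷ 122121120000 ∷ 122112210000 ∷ 121211220000 ∷ 112200002222 ∷ 000012122121 ∷ 000012121212 ∷ 101022002211 ∷ 101022001122 ∷ 112200001111 ∷ 111111110000 ∷ []) 1 false
    (refer 61 34794433095978288 34794433095978288 ∷ []) ∷
  split (122121120000 ∷ 122112210000 ∷ 121211220000 ∷ 112200002222 ∷ 000012122121 ∷ 000012121212 ∷ 101022002211 ∷ 101022001122 ∷ 112200001111 ∷ 111111110000 ∷ []) 1 false
    (refer 0 553843650770828 34794433095978288 ∷ refer 0 553738887739532 28465102530858288 ∷ []) ∷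
  split (122112210000 ∷ 121211220000 ∷ 112200002222 ∷ 000012122121 ∷ 000012121212 ∷ 101022002211 ∷ 101022001122 ∷ 112200001111 ∷ 111111110000 ∷ []) 0 false
    (refer 0 9644321329640 34794433095978288 ∷ []) ∷
  split (122100001221 ∷ 121211220000 ∷ 112200002222 ∷ 000012122121 ∷ 000012121212 ∷ 101022002211 ∷ 101022001122 ∷ 112200001111 ∷ 111111110000 ∷ []) 0 true
    ([]) ∷
  split (121211220000 ∷ 112200002222 ∷ 000012122121 ∷ 000012121212 ∷ 101022002211 ∷ 101022001122 ∷ 112200001111 ∷ 111111110000 ∷ []) 0 false
    (refer 1 185318368164 34794433095978288 ∷ refer 1 185318478972 31872805301120304 ∷
     refer 0 185318368164 34794433095978288 ∷ refer 0 185254122852 28465102530858288 ∷ []) ∷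
  split (122121120000 ∷ 122112210000 ∷ 112200002222 ∷ 000012122121 ∷ 000012121212 ∷ 101022002211 ∷ 101022001122 ∷ 112200001111 ∷ 111111110000 ∷ []) 0 false
    (refer 0 24110803320 34794433095978288 ∷ []) ∷
  split (122112210000 ∷ 112200002222 ∷ 000012122121 ∷ 000012121212 ∷ 101022002211 ∷ 101022001122 ∷ 112200001111 ∷ 111111110000 ∷ []) 0 false
    (refer 1 10295464896 34794433095978288 ∷ refer 0 185318368164 34794433095978288 ∷
     refer 6 278712 36379513382404805 ∷ refer 6 278712 33457894393545413 ∷ []) ∷
  split (112200002222 ∷ 000012122121 ∷ 000012121212 ∷ 101022002211 ∷ 101022001122 ∷ 112200001111 ∷ 111111110000 ∷ []) 8 true
    (refer 2 3970458656 34794433095978288 ∷ refer 0 3970458656 34794433095978288 ∷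
     refer 0 3970463008 31872805301120304 ∷ refer 0 3987235888 27131319948930196 ∷
     refer 0 3987240240 30052930131790996 ∷ refer 2 4240008224 28465098510685421 ∷ []) ∷
  split (121211220000 ∷ 020112210110 ∷ 010212210220 ∷ 122100001221 ∷ 000012122121 ∷ 000012121212 ∷ 101022002211 ∷ 101022001122 ∷ 112200001111 ∷ 111111110000 ∷ []) 0 false
    (refer 18 1188 33156588803897871 ∷ refer 18 1672 33156583820940948 ∷ []) ∷
  split (020112210110 ∷ 010212210220 ∷ 122100001221 ∷ 000012122121 ∷ 000012121212 ∷ 101022002211 ∷ 101022001122 ∷ 112200001111 ∷ 111111110000 ∷ []) 4 false
    (refer 0 9644321329640 34794433095978288 ∷ []) ∷
  split (010212210220 ∷ 122100001221 ∷ 000012122121 ∷ 000012121212 ∷ 101022002211 ∷ 101022001122 ∷ 112200001111 ∷ 111111110000 ∷ []) 9 false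
    (refer 0 185318368164 34794433095978288 ∷ []) ∷
  split (122100001221 ∷ 000012122121 ∷ 000012121212 ∷ 101022002211 ∷ 101022001122 ∷ 112200001111 ∷ 111111110000 ∷ []) 0 true
    (refer 0 3970458656 34794433095978288 ∷ refer 0 4240012576 25543488327824621 ∷
     refer 0 3987235888 27131319948930196 ∷ refer 0 4256789808 36382274288850313 ∷ []) ∷
  split (000012122121 ∷ 000012121212 ∷ 101022002211 ∷ 101022001122 ∷ 112200001111 ∷ 111111110000 ∷ []) 6 true
    (refer 4 96057276 34794433095978288 ∷ refer 0 96057276 34794433095978288 ∷
     refer 0 103627972 28465098510685421 ∷ refer 12 492828 27136374607383700 ∷
     refer 12 492828 30047866667338900 ∷ refer 0 104165796 33460646493992329 ∷
     refer 0 96595100 27131319948930196 ∷ refer 12 509292 31700842599142401 ∷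
     refer 12 509292 30224842711356417 ∷ refer 4 96595100 27131319948930196 ∷
     refer 12 490084 31877868765572400 ∷ refer 12 490084 34789360825527600 ∷
     refer 12 509292 31700824987145217 ∷ refer 12 509292 30224825099359233 ∷ []) ∷
  split (122100210012 ∷ 000012211221 ∷ 000012121212 ∷ 101022002211 ∷ 101022001122 ∷ 112200001111 ∷ 111111110000 ∷ []) 6 true
    (refer 0 16033984 30364070371790723 ∷ refer 0 16034000 34726262609268611 ∷ []) ∷
  split (000012211221 ∷ 000012121212 ∷ 101022002211 ∷ 101022001122 ∷ 112200001111 ∷ 111111110000 ∷ []) 10 false
    (refer 0 96057276 34794433095978288 ∷ refer 0 104165796 33460646493992329 ∷
     refer 1 7091826 34726262609268611 ∷ refer 1 6861204 31877868780834096 ∷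
     refer 1 6861246 31872805301120304 ∷ []) ∷
  split (000012121212 ∷ 101022002211 ∷ 101022001122 ∷ 112200001111 ∷ 111111110000 ∷ []) 1 true
    (refer 17 222096 31877868780834096 ∷ refer 17 222096 34789360840789296 ∷
     refer 17 222096 31877877556309296 ∷ refer 17 222096 34789369616264496 ∷
     refer 17 223824 30047866682600596 ∷ refer 17 223824 27136374622645396 ∷
     refer 17 223824 30047875458075796 ∷ refer 17 223824 27136383398120596 ∷
     refer 15 222096 31877877571570992 ∷ refer 15 222096 34789369631526192 ∷
     refer 15 222096 31877868765572400 ∷ refer 15 222096 34789360825527600 ∷
     refer 15 232464 31700824987116467 ∷ refer 15 232464 30224825099330483 ∷
     refer 15 234192 27313333039404033 ∷ refer 15 234192 34612317047100417 ∷
     refer 2 2665176 34794433095978288 ∷ refer 0 2665176 34794433095978288 ∷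
     refer 0 2685912 27131319948930196 ∷ refer 0 2685924 30052930131790996 ∷
     refer 0 2665188 31872805301120304 ∷ refer 2 2665188 31872805301120304 ∷ []) ∷
  split (101022002211 ∷ 101022001122 ∷ 112200001111 ∷ 111111110000 ∷ []) 1 true
    (refer 18 86420 34794433095978288 ∷ refer 18 87420 30052938937789588 ∷ refer 16 86420 34794433095978288 ∷
     refer 16 97530 33460655299990921 ∷ refer 0 86420 34794433095978288 ∷ []) ∷
  split (000012121212 ∷ 102011220022 ∷ 101022001122 ∷ 112200001111 ∷ 111111110000 ∷ []) 0 false
    (refer 27 1320 23608421937346171 ∷ refer 27 1176 17279105519779604 ∷ []) ∷
  split (102011220022 ∷ 101022001122 ∷ 112200001111 ∷ 111111110000 ∷ []) 0 true
    (refer 0 86420 34794433095978288 ∷ []) ∷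
  split (121211220000 ∷ 102012122020 ∷ 101022001122 ∷ 112200001111 ∷ 111111110000 ∷ []) 9 true
    (refer 2 14160 20456500893284328 ∷ refer 2 15900 23367997739161228 ∷ []) ∷
  split (102012122020 ∷ 101022001122 ∷ 112200001111 ∷ 111111110000 ∷ []) 0 false
    (refer 0 86420 34794433095978288 ∷ refer 0 68240 21970256613901680 ∷ refer 3 8640 34794433095978288 ∷
     refer 3 6820 21970256613901680 ∷ []) ∷
  split (122112210000 ∷ 001210201212 ∷ 101022001122 ∷ 112200001111 ∷ 111111110000 ∷ []) 8 true
    ([]) ∷
  split (001210201212 ∷ 101022001122 ∷ 112200001111 ∷ 111111110000 ∷ []) 8 true
    (refer 0 86420 34794433095978288 ∷ refer 0 97530 36382274288850313 ∷ []) ∷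
  split (121211220000 ∷ 112200002222 ∷ 000012122121 ∷ 000012121212 ∷ 101022001122 ∷ 112200001111 ∷ 111111110000 ∷ []) 8 true
    (refer 6 2756 36379517777734728 ∷ refer 6 2756 36379522173130776 ∷ refer 6 6852 36379522173130776 ∷
     refer 6 6852 36379517777734728 ∷ []) ∷
  split (112200002222 ∷ 000012122121 ∷ 000012121212 ∷ 101022001122 ∷ 112200001111 ∷ 111111110000 ∷ []) 8 true
    (refer 0 96057276 34794433095978288 ∷ refer 7 1710 36379517777734728 ∷ refer 7 1710 36379522173130776 ∷
     refer 7 4454 36379522173130776 ∷ refer 7 4454 36379517777734728 ∷ refer 0 103625228 28465098510685421 ∷
     []) ∷
  split (122100001221 ∷ 000012122121 ∷ 000012121212 ∷ 101022001122 ∷ 112200001111 ∷ 111111110000 ∷ []) 0 true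
    (refer 8 1724 24408166916848605 ∷ refer 8 1724 24408171312244653 ∷ refer 8 4468 24408171312244653 ∷
     refer 8 4468 24408166916848605 ∷ []) ∷
  split (000012122121 ∷ 000012121212 ∷ 101022001122 ∷ 112200001111 ∷ 111111110000 ∷ []) 6 true
    (refer 36 1320 23608421937374921 ∷ refer 1 2665176 34794433095978288 ∷ refer 0 2665176 34794433095978288 ∷
     refer 0 2915736 28465098510685421 ∷ refer 36 1320 23616026497050477 ∷ refer 3 18648 27136374607383700 ∷
     refer 3 18648 30047866667338900 ∷ refer 9 19368 34612334659068851 ∷ refer 36 1176 23608436069609158 ∷
     refer 0 2936472 33460646493992329 ∷ refer 0 2685912 27131319948930196 ∷ refer 3 19512 31700842599142401 ∷
     refer 3 19512 30224842711356417 ∷ refer 1 2685912 27131319948930196 ∷ refer 36 1176 23616021521747490 ∷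
     refer 9 17652 33156583843236776 ∷ refer 3 18504 31877868765572400 ∷ refer 3 18504 34789360825527600 ∷
     refer 3 19512 31700824987145217 ∷ refer 3 19512 30224825099359233 ∷ []) ∷
  split (000012211221 ∷ 000012121212 ∷ 101022001122 ∷ 112200001111 ∷ 111111110000 ∷ []) 1 true
    (refer 10 19368 34738921270398851 ∷ refer 8 18504 34794433095978288 ∷ refer 8 20244 28465107316684013 ∷
     refer 8 18648 30052938937789588 ∷ refer 8 20388 36382274288850313 ∷ refer 10 17652 33029997231906776 ∷
     refer 0 222096 34794433095978288 ∷ refer 0 222072 31877868780834096 ∷ refer 0 222084 34789369616264496 ∷
     refer 0 222108 31872805301120304 ∷ []) ∷
  split (000012121212 ∷ 101022001122 ∷ 112200001111 ∷ 111111110000 ∷ []) 1 true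
    (refer 38 360 10791849999721990 ∷ refer 38 260 10791841010611796 ∷ refer 11 9240 31700842599113651 ∷
     refer 9 8640 34794433095978288 ∷ refer 7 8640 31877868780834096 ∷ refer 7 8640 34789360840789296 ∷
     refer 7 8640 31877877556309296 ∷ refer 7 8640 34789369616264496 ∷ refer 9 9650 28465107316684013 ∷
     refer 38 380 6229487244534590 ∷ refer 38 280 6229491624670092 ∷ refer 9 8740 30052938937789588 ∷
     refer 7 8740 30047866682600596 ∷ refer 7 8740 27136374622645396 ∷ refer 7 8740 30047875458075796 ∷
     refer 7 8740 27136383398120596 ∷ refer 9 9750 36382274288850313 ∷ refer 11 8250 36068075903191976 ∷
     refer 38 360 10779186752399202 ∷ refer 38 260 10779196107847600 ∷ refer 38 280 6214301254153448 ∷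
     refer 38 380 6214296843494554 ∷ refer 38 480 21462814559462980 ∷ refer 38 480 18424735872917188 ∷
     refer 5 8640 31877877571570992 ∷ refer 5 8640 34789369631526192 ∷ refer 5 8640 31877868765572400 ∷
     refer 5 8640 34789360825527600 ∷ refer 5 9240 31700824987116467 ∷ refer 5 9240 30224825099330483 ∷
     refer 5 9340 27313333039404033 ∷ refer 5 9340 34612317047100417 ∷ refer 38 580 21447619396686392 ∷
     refer 38 580 18404477245714954 ∷ refer 1 86420 34794433095978288 ∷ refer 0 86420 34794433095978288 ∷
     refer 0 87420 27131319948930196 ∷ refer 0 87430 30052930131790996 ∷ refer 0 86430 31872805301120304 ∷
     refer 1 86430 31872805301120304 ∷ []) ∷
  split (101022001122 ∷ 112200001111 ∷ 111111110000 ∷ []) 1 true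
    (refer 39 416 34662783020223792 ∷ refer 12 3344 34794433095978288 ∷ refer 10 3344 34794433095978288 ∷
     refer 8 3344 34794433095978288 ∷ refer 10 3864 28465107316684013 ∷ refer 39 176 21447614406252192 ∷
     refer 10 3408 30052938937789588 ∷ refer 8 3408 30052938937789588 ∷ refer 10 3928 36382274288850313 ∷
     refer 12 3864 28465107316684013 ∷ refer 39 480 34672914719692013 ∷ refer 39 240 21462809584062776 ∷
     refer 39 176 21462814559462980 ∷ refer 6 3344 34794433095978288 ∷ refer 6 3928 33460655299990921 ∷
     refer 39 240 21447619381424696 ∷ refer 0 3344 34794433095978288 ∷ []) ∷
  split (111202202200 ∷ 001112221100 ∷ 112200001111 ∷ 111111110000 ∷ []) 10 true
    ([]) ∷
  split (121201201200 ∷ 001112221100 ∷ 112200001111 ∷ 111111110000 ∷ []) 5 true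
    ([]) ∷
  split (001112221100 ∷ 112200001111 ∷ 111111110000 ∷ []) 10 true
    (refer 1 3344 34794433095978288 ∷ refer 0 3344 34794433095978288 ∷ refer 42 416 34662783004962096 ∷
     refer 2 304 22091779760751984 ∷ refer 1 3928 36382274288823817 ∷ refer 2 368 21843674788410580 ∷
     refer 42 480 34672905165870317 ∷ []) ∷
  split (122100001221 ∷ 112200002222 ∷ 222211110000 ∷ 212112210000 ∷ 000012122121 ∷ 121212210000 ∷ 000012121212 ∷ 000011222211 ∷ 000011221122 ∷ 112200001111 ∷ 111111110000 ∷ []) 0 false
    (refer 95 34794433095978288 34794433095978288 ∷ []) ∷
  split (112200002222 ∷ 222211110000 ∷ 212112210000 ∷ 000012122121 ∷ 121212210000 ∷ 000012121212 ∷ 000011222211 ∷ 000011221122 ∷ 112200001111 ∷ 111111110000 ∷ []) 0 false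
    (refer 0 553843650770828 34794433095978288 ∷ refer 0 553738887739532 28465102530858288 ∷ []) ∷
  split (122100001221 ∷ 222211110000 ∷ 212112210000 ∷ 000012122121 ∷ 121212210000 ∷ 000012121212 ∷ 000011222211 ∷ 000011221122 ∷ 112200001111 ∷ 111111110000 ∷ []) 0 false
    (refer 0 25174711398672 34794433095978288 ∷ refer 0 24296697422096 34738955137578384 ∷ []) ∷
  split (222211110000 ∷ 212112210000 ∷ 000012122121 ∷ 121212210000 ∷ 000012121212 ∷ 000011222211 ∷ 000011221122 ∷ 112200001111 ∷ 111111110000 ∷ []) 0 false
    (refer 1 9644321329640 34794433095978288 ∷ refer 0 9644321329640 34794433095978288 ∷
     refer 0 9641889329640 28465102530858288 ∷ []) ∷
  split (212112210000 ∷ 000012122121 ∷ 121212210000 ∷ 000012121212 ∷ 000011222211 ∷ 000011221122 ∷ 112200001111 ∷ 111111110000 ∷ []) 4 false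
    (refer 0 185318368164 34794433095978288 ∷ []) ∷
  split (000012122121 ∷ 121212210000 ∷ 000012121212 ∷ 000011222211 ∷ 000011221122 ∷ 112200001111 ∷ 111111110000 ∷ []) 4 false
    (refer 0 3970458656 34794433095978288 ∷ refer 48 1056 33156574831857296 ∷ refer 48 1056 34604725665156752 ∷
     refer 48 1056 33143930119917200 ∷ refer 48 1056 34612334811025040 ∷ refer 0 1286106656 34794432928721832 ∷
     refer 8 1056 28528582111583888 ∷ refer 8 1056 34857912676703888 ∷ []) ∷
  split (121212210000 ∷ 000012121212 ∷ 000011222211 ∷ 000011221122 ∷ 112200001111 ∷ 111111110000 ∷ []) 0 true
    (refer 9 448 36318707863306763 ∷ refer 9 448 29989377298186763 ∷ refer 9 644 36318712632516084 ∷
     refer 9 644 29989382067396084 ∷ refer 0 96057276 34794433095978288 ∷ refer 0 103587008 31872799815798079 ∷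
     []) ∷
  split (000012122121 ∷ 112200002222 ∷ 222211110000 ∷ 000012121212 ∷ 000011222211 ∷ 000011221122 ∷ 112200001111 ∷ 111111110000 ∷ []) 4 true
    (refer 0 10156788 15762421678779675 ∷ refer 0 8267220 15762454347709567 ∷ []) ∷
  split (000012211221 ∷ 112200002222 ∷ 222211110000 ∷ 000012121212 ∷ 000011222211 ∷ 000011221122 ∷ 112200001111 ∷ 111111110000 ∷ []) 4 true
    (refer 11 720 7753757226591069 ∷ refer 11 1044 7753752838879919 ∷ []) ∷
  split (112200002222 ∷ 222211110000 ∷ 000012121212 ∷ 000011222211 ∷ 000011221122 ∷ 112200001111 ∷ 111111110000 ∷ []) 0 true
    (refer 1 3970458656 34794433095978288 ∷ refer 0 3970458656 34794433095978288 ∷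
     refer 0 3968492576 28465102530858288 ∷ refer 0 3969606688 34794414018858288 ∷
     refer 0 3971572768 28465083453738288 ∷ refer 1 3970462752 31872805301120304 ∷ []) ∷
  split (222211110000 ∷ 000012121212 ∷ 000011222211 ∷ 000011221122 ∷ 112200001111 ∷ 111111110000 ∷ []) 4 true
    (refer 0 96057276 34794433095978288 ∷ refer 13 812 7690741443196044 ∷ refer 13 812 7690722366076044 ∷
     refer 13 1008 7690737040167998 ∷ refer 13 1008 7690717963047998 ∷ refer 3 6018824 15762445541768475 ∷
     refer 3 5481000 15762430484720767 ∷ refer 0 96595100 27131319948930196 ∷ []) ∷
  split (000012212112 ∷ 000012211221 ∷ 000012122121 ∷ 000012121212 ∷ 000011222211 ∷ 000011221122 ∷ 112200001111 ∷ 111111110000 ∷ []) 4 false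
    (refer 0 31751388 34662765072469296 ∷ []) ∷
  split (000012211221 ∷ 000012122121 ∷ 000012121212 ∷ 000011222211 ∷ 000011221122 ∷ 112200001111 ∷ 111111110000 ∷ []) 4 false
    (refer 55 3392 18998146916739017 ∷ refer 55 3136 18998141941382946 ∷ refer 1 15492128 28839780952558896 ∷
     refer 0 3970458656 34794433095978288 ∷ []) ∷
  split (000012122121 ∷ 000012121212 ∷ 000011222211 ∷ 000011221122 ∷ 112200001111 ∷ 111111110000 ∷ []) 4 false
    (refer 6 6861204 31872814107118896 ∷ refer 56 2184 18998146916739017 ∷ refer 56 2184 18998146916791917 ∷
     refer 16 2184 23616026329171913 ∷ refer 16 2184 23616026329224813 ∷ refer 56 1988 18998141941435846 ∷
     refer 56 1988 18998141941382946 ∷ refer 2 6861204 31872814107118896 ∷ refer 16 1988 23616030732180934 ∷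
     refer 16 1988 23616030732128034 ∷ refer 16 2380 28528577333968040 ∷ refer 16 2380 34857907899088040 ∷
     refer 0 96057276 34794433095978288 ∷ refer 0 96595100 27131319948930196 ∷ []) ∷
  split (000012211221 ∷ 000012121212 ∷ 000011222211 ∷ 000011221122 ∷ 112200001111 ∷ 111111110000 ∷ []) 4 false
    (refer 17 728 7753776303804978 ∷ refer 57 2184 22036225588048413 ∷ refer 57 2212 18998146916763167 ∷
     refer 57 1988 22036220612694550 ∷ refer 57 2016 18998141941464596 ∷ refer 3 6861204 31877868780834096 ∷
     refer 0 6861232 34794433095978288 ∷ refer 0 6861204 31877868780834096 ∷ []) ∷
  split (000012121212 ∷ 000011222211 ∷ 000011221122 ∷ 112200001111 ∷ 111111110000 ∷ []) 4 false
    (refer 8 2665176 34794433095978288 ∷ refer 18 528 7753771908408930 ∷ refer 18 528 7753771908355846 ∷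
     refer 58 1344 23494503350254361 ∷ refer 58 1320 18998146916763167 ∷ refer 58 1320 18998146916710267 ∷
     refer 18 1320 23616026329196063 ∷ refer 18 1320 23616026329143163 ∷ refer 58 1200 23494498374842998 ∷
     refer 58 1176 18998141941411696 ∷ refer 58 1176 18998141941464596 ∷ refer 4 2665176 34794433095978288 ∷
     refer 18 1176 23616030732156784 ∷ refer 18 1176 23616030732209684 ∷ refer 18 1464 36318717393517736 ∷
     refer 18 1464 29989386828397736 ∷ refer 1 2665176 34794433095978288 ∷ refer 0 2665176 34794433095978288 ∷
     refer 0 2685912 27131319948930196 ∷ []) ∷
  split (000011222211 ∷ 000011221122 ∷ 112200001111 ∷ 111111110000 ∷ []) 0 true
    (refer 19 920 34609802926815157 ∷ refer 19 720 20456424511118105 ∷ refer 19 620 20456428914045476 ∷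
     refer 19 820 34609798140989432 ∷ refer 19 702 18998132764981939 ∷ refer 19 602 18998127945924668 ∷
     refer 19 802 36068057258597096 ∷ refer 19 902 36068062011276279 ∷ refer 0 86420 34794433095978288 ∷ []) ∷
  split (121212210000 ∷ 000012121212 ∷ 000011221122 ∷ 112200001111 ∷ 111111110000 ∷ []) 0 true
    (refer 60 528 31619631323657210 ∷ refer 60 528 31634835864605690 ∷ refer 20 336 36318707863306763 ∷
     refer 20 336 29989377298186763 ∷ refer 60 600 6095529967278800 ∷ refer 60 744 6095525007196550 ∷
     refer 60 744 6095525587127773 ∷ refer 60 600 6095516018128331 ∷ refer 60 600 6105656705411792 ∷
     refer 60 744 6105652508414342 ∷ refer 60 744 6105647349947869 ∷ refer 60 600 6105656919115211 ∷
     refer 60 384 31619641083551431 ∷ refer 60 384 31634826486333127 ∷ refer 20 480 36318712632516084 ∷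
     refer 20 480 29989382067396084 ∷ refer 0 4680 34794432928735080 ∷ refer 0 4656 34672910148165480 ∷
     refer 0 14160 22157824949228328 ∷ refer 0 14184 22036302168658728 ∷ []) ∷
  split (000012211221 ∷ 000012121212 ∷ 000011221122 ∷ 112200001111 ∷ 111111110000 ∷ []) 0 true
    (refer 1 18504 34794433095978288 ∷ refer 1 18480 34672909582847280 ∷ refer 1 18456 31634821754572080 ∷
     refer 1 15288 18932168785626480 ∷ refer 1 15312 21970256613901680 ∷ refer 1 15336 22091780127032688 ∷ []) ∷
  split (000012121212 ∷ 000011221122 ∷ 112200001111 ∷ 111111110000 ∷ []) 4 false
    (refer 1 86420 34794433095978288 ∷ refer 22 360 7753771908408930 ∷ refer 22 360 7753771908355846 ∷
     refer 22 560 7753771542100580 ∷ refer 22 560 7753771542074038 ∷ refer 22 360 7753766780478982 ∷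
     refer 19 740 23676788070472317 ∷ refer 62 740 23494503350196861 ∷ refer 62 720 18998146916763167 ∷
     refer 62 720 18998146916710267 ∷ refer 62 360 10791849999721990 ∷ refer 22 720 23616026329196063 ∷
     refer 22 720 23616026329143163 ∷ refer 62 280 9267570295874792 ∷ refer 19 640 23676783095202496 ∷
     refer 62 640 23494498374900498 ∷ refer 62 620 18998141941411696 ∷ refer 62 620 18998141941464596 ∷
     refer 2 2680 10974139519829680 ∷ refer 22 620 23616030732156784 ∷ refer 22 620 23616030732209684 ∷
     refer 62 280 9257443176199400 ∷ refer 62 360 10779191910905350 ∷ refer 62 260 10779196321564244 ∷
     refer 62 360 10779186752399202 ∷ refer 22 820 36318717393517736 ∷ refer 22 820 29989386828397736 ∷
     refer 2 8640 34794433095978288 ∷ refer 2 8620 34672909582847280 ∷ refer 0 86420 34794433095978288 ∷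
     refer 0 87420 27131319948930196 ∷ []) ∷
  split (000011221122 ∷ 112200001111 ∷ 111111110000 ∷ []) 0 true
    (refer 63 224 10791850381236836 ∷ refer 63 160 10791845405981440 ∷ refer 23 464 33159120361289653 ∷
     refer 23 336 20456424511060605 ∷ refer 63 176 9267560742107192 ∷ refer 63 240 9267565717362588 ∷
     refer 23 272 20456428914102976 ∷ refer 63 176 9257443573057592 ∷ refer 63 240 9257438597687196 ∷
     refer 63 224 10779191529335396 ∷ refer 63 160 10779196504705792 ∷ refer 23 400 33159115575463928 ∷
     refer 20 416 28465102530858288 ∷ refer 20 416 34794432699174192 ∷ refer 20 240 3059758108321692 ∷
     refer 20 176 3059763083692088 ∷ refer 23 258 18998127979099960 ∷ refer 23 322 18998132731806647 ∷
     refer 23 386 31700819168664296 ∷ refer 23 450 31700823921343479 ∷ refer 20 224 3062471704341092 ∷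
     refer 20 304 22091779730228592 ∷ refer 20 160 3062476679711488 ∷ refer 20 304 15762449561912688 ∷
     refer 3 3344 34794433095978288 ∷ refer 0 3344 34794433095978288 ∷ refer 3 2448 22091780127032688 ∷ []) ∷
  split (112200001111 ∷ 111111110000 ∷ []) 0 true
    (refer 64 156 34794433095978288 ∷ refer 24 156 34794433095978288 ∷ refer 24 96 22091780127032688 ∷
     refer 64 96 22091780127032688 ∷ refer 24 132 22091784912843988 ∷ refer 64 132 22091775343760596 ∷
     refer 64 192 34794428312720621 ∷ refer 24 192 34794437881804013 ∷ refer 21 156 34794433095978288 ∷
     refer 21 138 23679611750792521 ∷ refer 24 112 23676869304464716 ∷ refer 24 182 36379522339668559 ∷
     refer 21 198 36382264719766921 ∷ refer 21 96 22091780127032688 ∷ refer 0 156 34794433095978288 ∷ []) ∷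
  split (120112201010 ∷ 112122002200 ∷ 111222001100 ∷ 111111110000 ∷ []) 0 true
    (refer 0 20 34658365425638718 ∷ refer 0 20 34719126999002989 ∷ refer 0 20 34658475500951238 ∷
     refer 0 20 34719237074275696 ∷ []) ∷
  split (112211220000 ∷ 121221002200 ∷ 120012121200 ∷ 112122002200 ∷ 111222001100 ∷ 111111110000 ∷ []) 0 true
    ([]) ∷
  split (122121001100 ∷ 121221002200 ∷ 120012121200 ∷ 112122002200 ∷ 111222001100 ∷ 111111110000 ∷ []) 0 false
    (refer 0 6789860 34792121514354096 ∷ refer 0 3635436 34764056840185608 ∷ refer 2 28 34783554748556280 ∷
     refer 2 84 34764166977541824 ∷ refer 2 28 34786157913581040 ∷ []) ∷
  split (121221002200 ∷ 120012121200 ∷ 112122002200 ∷ 111222001100 ∷ 111111110000 ∷ []) 0 false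
    (refer 1 2665176 34794433095978288 ∷ refer 0 2665176 34794433095978288 ∷
     refer 1 1135032 34758993375693768 ∷ refer 3 24 34783559526129576 ∷ refer 3 48 34764166977541824 ∷
     refer 3 24 34786158096762840 ∷ []) ∷
  split (120012121200 ∷ 112122002200 ∷ 111222001100 ∷ 111111110000 ∷ []) 6 true
    (refer 0 86420 34794433095978288 ∷ refer 3 3640 34764048034160313 ∷ refer 0 97520 34792117494265179 ∷
     refer 3 9640 34794429009481425 ∷ refer 3 8640 34789360825527600 ∷ refer 3 2640 34756448495556360 ∷
     refer 4 20 34764166977541824 ∷ refer 0 96420 34794429009481379 ∷ refer 3 3640 34764048102838106 ∷
     refer 0 87520 34792121447999096 ∷ refer 3 9640 34794429024743075 ∷ refer 3 8640 34789360840789250 ∷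
     refer 3 2640 34756448457401867 ∷ refer 4 20 34761415094526424 ∷ refer 4 20 34764166952540824 ∷
     refer 4 20 34761415069804299 ∷ []) ∷
  split (112122002200 ∷ 111222001100 ∷ 111111110000 ∷ []) 2 true
    (refer 4 3344 34794433095978288 ∷ refer 4 3928 34797189749454171 ∷ refer 0 3344 34794433095978288 ∷
     refer 5 16 34786091227167624 ∷ refer 5 48 34797074870395200 ∷ refer 5 16 34786053006683208 ∷
     refer 5 16 34786162499734536 ∷ refer 5 16 34783410616874961 ∷ refer 5 16 34786029276408851 ∷ []) ∷
  split (120112201001 ∷ 112120202010 ∷ 111222001100 ∷ 111111110000 ∷ []) 7 true
    (refer 6 80 36316224313133376 ∷ refer 6 80 34860478283182226 ∷ []) ∷
  split (120112200120 ∷ 112120202010 ∷ 111222001100 ∷ 111111110000 ∷ []) 0 true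
    ([]) ∷
  split (120121021020 ∷ 112120202010 ∷ 111222001100 ∷ 111111110000 ∷ []) 0 true
    ([]) ∷
  split (120120121200 ∷ 112120202010 ∷ 111222001100 ∷ 111111110000 ∷ []) 0 true
    ([]) ∷
  split (112120202010 ∷ 111222001100 ∷ 111111110000 ∷ []) 2 true
    (refer 3 3344 34794433095978288 ∷ refer 2 3344 34794433095978288 ∷ refer 2 3032 34849604715617115 ∷
     refer 10 16 34659179032132368 ∷ refer 2 1076 34160315448138192 ∷ refer 1 3344 34794433095978288 ∷
     refer 1 2448 34783444682530608 ∷ refer 0 3344 34794433095978288 ∷ refer 10 32 34849489870012248 ∷
     refer 10 48 34860478283183376 ∷ refer 1 3032 34849604715617115 ∷ refer 1 3928 34860593145681243 ∷
     refer 0 3928 34860593145681243 ∷ refer 10 32 34783554756848424 ∷ refer 10 48 34794543169964352 ∷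
     refer 3 2448 34783444682530608 ∷ refer 2 3928 34860593145681243 ∷ refer 2 2448 34783444682530608 ∷
     refer 10 16 34719830530201944 ∷ refer 2 1140 34160315448110546 ∷ refer 10 16 34722419719929720 ∷
     refer 10 16 34722529795241688 ∷ refer 10 16 34656374531373037 ∷ refer 10 16 34656484606631921 ∷
     refer 10 16 34659016123309950 ∷ refer 10 16 34722529579545894 ∷ refer 10 16 34659126198621918 ∷
     refer 10 16 34719887772049278 ∷ refer 10 16 34659016123207025 ∷ refer 10 16 34719777696687469 ∷
     refer 10 16 34656374315763493 ∷ refer 10 16 34719887771946353 ∷ refer 10 16 34659002363849773 ∷
     refer 10 16 34659112439108657 ∷ refer 10 16 34719874012589101 ∷ refer 10 16 34656470631665125 ∷
     refer 10 16 34722405744817449 ∷ refer 10 16 34659002363893473 ∷ refer 10 16 34719763937320833 ∷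
     refer 10 16 34719874012632801 ∷ []) ∷
  split (111222001100 ∷ 111111110000 ∷ []) 6 true
    (refer 5 156 34794433095978288 ∷ refer 0 156 34794433095978288 ∷ refer 11 24 34797184978832688 ∷
     refer 5 162 34797184928986950 ∷ refer 0 198 34797189764077755 ∷ refer 11 24 34794433095949584 ∷
     refer 0 162 34797184928986950 ∷ refer 0 192 34794437831377617 ∷ refer 11 24 34797074902218000 ∷
     refer 11 24 34797184929123984 ∷ refer 11 24 34794433046265030 ∷ []) ∷
  split (111111110000 ∷ []) 0 true
    (refer 0 8 34794433095978288 ∷ refer 12 8 34794433095978288 ∷ []) ∷
  split ([]) 0 false
    (refer 0 0 34794433095978288 ∷ []) ∷
  []

-- Evaluation of the representatives and of the certificate.

⟪_⟫ : ∀ {n} → Vec (Vec Trit n) n → Matrix n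
⟪ R ⟫ i j = val (⟦ R ⟧ i j)

representative : Fin 7 → Matrix 12
representative r = ⟪ lookup representatives r ⟫

decided : ∀ {P : Set} (p? : Dec P) → does p? ≡ true → P
decided (yes p) _ = p

representative-weighing : ∀ r → IsWeighing 12 8 (representative r)
representative-weighing r =
  (λ i j → val-ternary (⟦ lookup representatives r ⟧ i j)) ,
  decided (Fin.all? λ r → Fin.all? λ i → Fin.all? λ j →
    (representative r ⊗ (representative r ᵀ)) i j ℤ.≟ scalarId (+ 8) i j) refl r
  where
  val-ternary : ∀ x → Ternary (val x)
  val-ternary ⊕ = inj₁ refl
  val-ternary ⊖ = inj₂ (inj₁ refl)
  val-ternary ⊙ = inj₂ (inj₂ refl)

-- The invariants are evaluated here once; afterwards only the numerals are compared.
spreads-correct : spreads ≡ tabulate (λ r → spread (representative r))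
spreads-correct = refl

spread-representative : ∀ r → spread (representative r) ≡ lookup spreads r
spread-representative r = begin
  spread (representative r)                             ≡⟨ lookup∘tabulate (λ r → spread (representative r)) r ⟨
  lookup (tabulate (λ r → spread (representative r))) r ≡⟨ cong (λ xs → lookup xs r) spreads-correct ⟨
  lookup spreads r                                      ∎
  where open ≡-Reasoning

spreads-distinct : ∀ r s → lookup spreads r ≡ lookup spreads s → r ≡ s
spreads-distinct = decided (Fin.all? λ r → Fin.all? λ s →
  (lookup spreads r ℕ.≟ lookup spreads s) →-dec (r Fin.≟ s)) refl

Classified : Pattern 12 12 → Set
Classified W = ∃ λ r → ⟦ lookup representatives r ⟧ ⊑ W

startingPoint : Fin 7 → Configuration 12
startingPoint r = 12 , lookup representatives r

startingPoints : List (Configuration 12)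
startingPoints = List.map startingPoint (List.allFin 7)

abstract
  checked : check 8 startingPoints branchings ≡ true
  checked = refl

  classified : ∀ {W} → Orthogonal 8 W → Classified W
  classified = check-sound startingPoints branchings startingPoints-settled checked
    where
    open Soundness {11} {8} Classified

    startingPoint-settled : ∀ r → Settled (startingPoint r)
    startingPoint-settled r _ R⊑W = r , R⊑W

    startingPoints-settled : ListAll.All Settled startingPoints
    startingPoints-settled = ListAll.map⁺ {f = startingPoint} (ListAll.universal startingPoint-settled (List.allFin 7))

-- Integer weighing matrices as patterns, and the classification.

module _ {n k} {M : Matrix n} (M-weighing : IsWeighing n k M) where

  trit : ∀ {x} → Ternary x → Trit
  trit (inj₁ _)        = ⊕
  trit (inj₂ (inj₁ _)) = ⊖
  trit (inj₂ (inj₂ _)) = ⊙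

  val-trit : ∀ {x} (p : Ternary x) → val (trit p) ≡ x
  val-trit (inj₁ refl)        = refl
  val-trit (inj₂ (inj₁ refl)) = refl
  val-trit (inj₂ (inj₂ refl)) = refl

  signPattern : Pattern n n
  signPattern i j = trit (proj₁ M-weighing i j)

  val-signPattern : ∀ i j → val (signPattern i j) ≡ M i j
  val-signPattern i j = val-trit (proj₁ M-weighing i j)

  signPattern-gram : ∀ i i′ → dot (signPattern i) (signPattern i′) ≡ scalarId (+ k) i i′
  signPattern-gram i i′ = begin
    dot (signPattern i) (signPattern i′)  ≡⟨ ∑-cong (λ j → cong₂ ℤ._*_ (val-signPattern i j) (val-signPattern i′ j)) ⟩
    ∑ (λ j → M i j ℤ.* M i′ j)            ≡⟨ sumFin≡∑ (λ j → M i j ℤ.* M i′ j) ⟨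
    (M ⊗ (M ᵀ)) i i′                      ≡⟨ proj₂ M-weighing i i′ ⟩
    scalarId (+ k) i i′                   ∎
    where open ≡-Reasoning

  signPattern-orthogonal : Orthogonal k signPattern
  signPattern-orthogonal = record
    { norm = λ i → trans (signPattern-gram i i) (diagonal i)
    ; orth = λ {i} {i′} i≢i′ → trans (signPattern-gram i i′) (off-diagonal i≢i′)
    }
    where
    diagonal : ∀ i → scalarId (+ k) i i ≡ + k
    diagonal i with i Fin.≟ i
    ... | yes _  = refl
    ... | no i≢i = contradiction refl i≢i

    off-diagonal : ∀ {i i′} → i ≢ i′ → scalarId (+ k) i i′ ≡ 0ℤ
    off-diagonal {i} {i′} i≢i′ with i Fin.≟ i′
    ... | yes i≡i′ = contradiction i≡i′ i≢i′
    ... | no _     = refl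

  ⊑signPattern⇒Equivalent : (R : Vec (Vec Trit n) n) → ⟦ R ⟧ ⊑ signPattern → Equivalent n M ⟪ R ⟫
  ⊑signPattern⇒Equivalent R = ⊑⇒Equivalent val-signPattern

theorem5p3 : Σ (Fin 7 → Matrix 12) λ Ws →
    (∀ r → IsWeighing 12 8 (Ws r)) ×
    (∀ r s → r ≢ s → ¬ Equivalent 12 (Ws r) (Ws s)) ×
    (∀ W → IsWeighing 12 8 W → ∃[ r ] Equivalent 12 W (Ws r))
theorem5p3 = representative , representative-weighing , inequivalent , complete
  where
  inequivalent : ∀ r s → r ≢ s → ¬ Equivalent 12 (representative r) (representative s)
  inequivalent r s r≢s equivalent = r≢s (spreads-distinct r s (begin
    lookup spreads r           ≡⟨ spread-representative r ⟨
    spread (representative r)  ≡⟨ spread-invariant {W₁ = representative r} {representative s} equivalent ⟩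
    spread (representative s)  ≡⟨ spread-representative s ⟩
    lookup spreads s           ∎))
    where open ≡-Reasoning

  complete : ∀ W → IsWeighing 12 8 W → ∃[ r ] Equivalent 12 W (representative r)
  complete W W-weighing =
    let r , R⊑W = classified (signPattern-orthogonal {12} {8} {W} W-weighing) in
    r , ⊑signPattern⇒Equivalent {12} {8} {W} W-weighing (lookup representatives r) R⊑W
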